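{- The \textsc{Paw-free Edge Addition} problem, parameterized by $k$, admits a kernel of size $\mathcal{O}(k^3)$: there is a polynomial-time algorithm that, given an instance $(G,k)$, outputs an equivalent instance $(G',k')$ of the same problem with $k'\le k$ and $G'$ having $\mathcal{O}(k^3)$ vertices.
   Context: The paw is the graph on four vertices $x_1,x_2,x_3,x_4$ with edges $x_1x_2,x_2x_3,x_1x_3,x_3x_4$. A graph is paw-free if it has no induced subgraph isomorphic to the paw. \textsc{Paw-free Edge Addition}: given a graph $G$ and an integer $k$, decide whether there is a set $A$ of at most $k$ unordered pairs of non-adjacent vertices of $G$ such that the graph obtained from $G$ by adding the pairs of $A$ as edges is paw-free. A kernel is a polynomial-time algorithm mapping an instance to an equivalent instance whose size is bounded by a function of $k$ only. -}

module Defs where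

open import Data.Bool.Base using (Bool; true; false; _∧_; _∨_)
open import Data.Bool.ListAction using (any)
open import Data.Bool.Properties using (∨-comm)
open import Data.Fin.Base using (Fin; zero; suc; _<_)
open import Data.Fin.Properties using (_≟_; <-irrefl)
open import Data.List.Base using (List; []; _∷_; length; foldr; tabulate)
open import Data.List.Relation.Unary.All using (All)
open import Data.List.Relation.Unary.Unique.Propositional using (Unique)
open import Data.Nat.Base using (ℕ; zero; suc; _+_; _*_; _^_; _≤_; z≤n; s≤s)
open import Data.Product.Base using (Σ-syntax; ∃-syntax; _×_; _,_)
open import Data.Vec.Base as Vec using (Vec; _∷_; lookup; replicate; _[_]≔_)
open import Function.Definitions using (Injective)
open import Relation.Binary.PropositionalEquality.Core
  using (_≡_; refl; cong₂)
open import Relation.Nullary.Decidable.Core using (does; yes; no)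
open import Relation.Nullary.Negation.Core using (¬_; contradiction-irr)

record Graph (n : ℕ) : Set where
  field
    adj    : Fin n → Fin n → Bool
    sym    : ∀ u v → adj u v ≡ adj v u
    irrefl : ∀ u → adj u u ≡ false

open Graph public

edgeless : ∀ n → Graph n
edgeless n = record
  { adj    = λ _ _ → false
  ; sym    = λ _ _ → refl
  ; irrefl = λ _ → refl
  }

-- An unordered pair of distinct vertices, listed in increasing order so that
-- each pair has exactly one representation.
record Pair (n : ℕ) : Set where
  constructor pair
  field
    fst snd : Fin n
    .fst<snd : fst < snd

open Pair public

joins : ∀ {n} → Pair n → Fin n → Fin n → Bool
joins (pair a b _) u v =
  (does (u ≟ a) ∧ does (v ≟ b)) ∨ (does (v ≟ a) ∧ does (u ≟ b))

joins-sym : ∀ {n} (p : Pair n) u v → joins p u v ≡ joins p v u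
joins-sym (pair a b _) u v =
  ∨-comm (does (u ≟ a) ∧ does (v ≟ b)) (does (v ≟ a) ∧ does (u ≟ b))

joins-irrefl : ∀ {n} (p : Pair n) u → joins p u u ≡ false
joins-irrefl (pair a b a<b) u with u ≟ a | u ≟ b
... | no _     | _        = refl
... | yes _    | no _     = refl
... | yes refl | yes refl = contradiction-irr a<b (<-irrefl refl)

infixl 6 _⊕_

_⊕_ : ∀ {n} → Graph n → List (Pair n) → Graph n
_⊕_ {n} G A = record
  { adj    = λ u v → adj G u v ∨ any (λ p → joins p u v) A
  ; sym    = λ u v → cong₂ _∨_ (sym G u v) (any-sym A u v)
  ; irrefl = λ u → cong₂ _∨_ (irrefl G u) (any-irrefl A u)
  }
  where
  any-sym : ∀ (B : List (Pair n)) u v →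
            any (λ p → joins p u v) B ≡ any (λ p → joins p v u) B
  any-sym []      u v = refl
  any-sym (p ∷ B) u v = cong₂ _∨_ (joins-sym p u v) (any-sym B u v)

  any-irrefl : ∀ (B : List (Pair n)) u → any (λ p → joins p u u) B ≡ false
  any-irrefl []      u = refl
  any-irrefl (p ∷ B) u = cong₂ _∨_ (joins-irrefl p u) (any-irrefl B u)

-- An isomorphism of H with an induced subgraph of G.
record InducedCopy {m n} (H : Graph m) (G : Graph n) : Set where
  field
    vertex    : Fin m → Fin n
    injective : Injective _≡_ _≡_ vertex
    preserves : ∀ u v → adj G (vertex u) (vertex v) ≡ adj H u v

pattern x₁ = zero
pattern x₂ = suc zero
pattern x₃ = suc (suc zero)
pattern x₄ = suc (suc (suc zero))

paw : Graph 4
paw = edgeless 4 ⊕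
  ( pair x₁ x₂ (s≤s z≤n)
  ∷ pair x₂ x₃ (s≤s (s≤s z≤n))
  ∷ pair x₁ x₃ (s≤s z≤n)
  ∷ pair x₃ x₄ (s≤s (s≤s (s≤s z≤n)))
  ∷ [] )

PawFree : ∀ {n} → Graph n → Set
PawFree G = ¬ InducedCopy paw G

record Instance : Set where
  constructor ⟨_,_⟩
  field
    {order} : ℕ
    graph   : Graph order
    budget  : ℕ

open Instance public

NonAdjacent : ∀ {n} → Graph n → Pair n → Set
NonAdjacent G p = adj G (fst p) (snd p) ≡ false

-- A duplicate-free list stands for a set of pairs.
PawFreeEdgeAddition : Instance → Set
PawFreeEdgeAddition ⟨ G , k ⟩ =
  ∃[ A ] Unique A × All (NonAdjacent G) A × length A ≤ k × PawFree (G ⊕ A)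

-- The machine model is Jones's WHILE language (Computability and Complexity
-- from a Programming Perspective, MIT Press, 1997): imperative programs over
-- binary trees, with unit cost per elementary operation.

data Tree : Set where
  nil  : Tree
  cons : Tree → Tree → Tree

left right : Tree → Tree
left nil         = nil
left (cons x _)  = x
right nil        = nil
right (cons _ y) = y

size : Tree → ℕ
size nil        = 1
size (cons x y) = 1 + size x + size y

Store : ℕ → Set
Store = Vec Tree

data Expr (n : ℕ) : Set where
  var   : Fin n → Expr n
  nil   : Expr n
  cons  : Expr n → Expr n → Expr n
  hd tl : Expr n → Expr n

eval : ∀ {n} → Expr n → Store n → Tree
eval (var x)    s = lookup s x
eval nil        s = nil
eval (cons e f) s = cons (eval e s) (eval f s)
eval (hd e)     s = left (eval e s)
eval (tl e)     s = right (eval e s)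

cost : ∀ {n} → Expr n → ℕ
cost (var x)    = 1
cost nil        = 1
cost (cons e f) = 1 + cost e + cost f
cost (hd e)     = 1 + cost e
cost (tl e)     = 1 + cost e

infix  6 _:=_
infixr 5 _⨾_

data Command (n : ℕ) : Set where
  skip          : Command n
  _:=_          : Fin n → Expr n → Command n
  _⨾_           : Command n → Command n → Command n
  if_then_else_ : Expr n → Command n → Command n → Command n
  while_loop_     : Expr n → Command n → Command n

infix 4 _⊢_⇓_[_]

-- c ⊢ s ⇓ s′ [ t ]: started in store s, the command c halts in store s′
-- after t steps.  A condition holds when its value is not nil.
data _⊢_⇓_[_] {n} : Command n → Store n → Store n → ℕ → Set where
  skip : ∀ {s} → skip ⊢ s ⇓ s [ 1 ]

  assign : ∀ {s x e} → x := e ⊢ s ⇓ s [ x ]≔ eval e s [ 1 + cost e ]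

  seq : ∀ {c d s s′ s″ t u} →
        c ⊢ s ⇓ s′ [ t ] → d ⊢ s′ ⇓ s″ [ u ] →
        c ⨾ d ⊢ s ⇓ s″ [ t + u ]

  if-true : ∀ {e c d s s′ x y t} → eval e s ≡ cons x y →
            c ⊢ s ⇓ s′ [ t ] →
            if e then c else d ⊢ s ⇓ s′ [ 1 + cost e + t ]

  if-false : ∀ {e c d s s′ t} → eval e s ≡ nil →
             d ⊢ s ⇓ s′ [ t ] →
             if e then c else d ⊢ s ⇓ s′ [ 1 + cost e + t ]

  while-true : ∀ {e c s s′ s″ x y t u} → eval e s ≡ cons x y →
               c ⊢ s ⇓ s′ [ t ] → while e loop c ⊢ s′ ⇓ s″ [ u ] →
               while e loop c ⊢ s ⇓ s″ [ 1 + cost e + t + u ]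

  while-false : ∀ {e c s} → eval e s ≡ nil →
                while e loop c ⊢ s ⇓ s [ 1 + cost e ]

-- On input x the program c, whose input/output variable is variable 0 and
-- whose other variables are initially nil, outputs y in t steps.
Computes : ∀ {m} → Command (suc m) → Tree → Tree → ℕ → Set
Computes {m} c x y t =
  ∃[ s ] c ⊢ x ∷ replicate m nil ⇓ s [ t ] × Vec.head s ≡ y

-- Trees are shared in this cost model, so a program could build a tree of
-- size exponential in its running time; the time to write out the output is
-- therefore charged as well.  With that charge, and since WHILE programs run
-- on pointer structures with constant overhead per step, this is the usual
-- class of polynomial-time computable functions.  As sizes are positive,
-- every polynomial is dominated by some a * size ^ d.
PolynomialTime : {X Y : Set} → (X → Tree) → (Y → Tree) → (X → Y) → Set
PolynomialTime {X} encX encY f =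
  Σ[ m ∈ ℕ ] Σ[ c ∈ Command (suc m) ] Σ[ a ∈ ℕ ] Σ[ d ∈ ℕ ]
    ((x : X) → ∃[ t ] Computes c (encX x) (encY (f x)) t
                    × t + size (encY (f x)) ≤ a * size (encX x) ^ d)

encodeBool : Bool → Tree
encodeBool false = nil
encodeBool true  = cons nil nil

encodeList : List Tree → Tree
encodeList = foldr cons nil

-- Adjacency matrix, as a list of rows.
encodeGraph : ∀ {n} → Graph n → Tree
encodeGraph G =
  encodeList (tabulate λ u → encodeList (tabulate λ v → encodeBool (adj G u v)))

-- The parameter is in unary: the size of an instance (G , k) of a
-- parameterized problem is, as usual, |G| + k.
encodeℕ : ℕ → Tree
encodeℕ zero    = nil
encodeℕ (suc k) = cons nil (encodeℕ k)

encodeInstance : Instance → Tree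
encodeInstance ⟨ G , k ⟩ = cons (encodeGraph G) (encodeℕ k)

infix 4 _∈O_

_∈O_ : (ℕ → ℕ) → (ℕ → ℕ) → Set
f ∈O g = Σ[ a ∈ ℕ ] Σ[ k₀ ∈ ℕ ] (∀ k → k₀ ≤ k → f k ≤ a * g k)

{-# OPTIONS --safe #-}

-- A connected paw-free graph with a triangle is complete multipartite.  Hence
-- a solution only concerns the components that contain a paw, and must make
-- each of them complete multipartite.  In such a component call a vertex clean
-- if it forms, with its non-neighbours, a class of twins; all clean vertices but
-- one can be deleted, since in a solution for the rest they are adjacent to
-- everything outside their class.  Of a class of twins it suffices to keep
-- 2k + 1 vertices: one of them is untouched by the at most k added edges, and
-- the deleted ones can be added back as copies of it.  If a solution exists,
-- then every kept vertex is an endpoint e of an added edge, or the clean vertex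
-- of the component of an endpoint e, or an untouched vertex in the part of an
-- endpoint e, and these are at most 1, 1 and 2k + 1 vertices for each of the at
-- most 2k endpoints e; so more than 2k (2k + 3) kept vertices mean no.
--
-- The selection is defined by first-order formulas with a threshold quantifier
-- over relations obtained by Warshall's algorithm and by earlier formulas.  Such
-- formulas are evaluated by tree functions built from expressions, pairing,
-- composition, case distinction and folds, which compile to WHILE programs that
-- use one accumulator and a stack.

module Submission where

open import Defs
open import Data.Nat.Base using (ℕ; _^_; _≤_)
open import Data.Product.Base using (Σ-syntax; _×_)
open import Function.Bundles using (_⇔_)

open import Data.Bool.Base using (Bool; true; false; _∧_; _∨_; not; T)
  renaming (if_then_else_ to ifᵇ_then_else_)
open import Data.Bool.ListAction using (any)
open import Data.Bool.Properties using (∧-comm; T?)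
open import Data.Empty using (⊥; ⊥-elim)
open import Data.Fin.Base using (Fin; zero; suc; toℕ)
open import Data.Fin.Patterns using (0F; 1F; 2F; 3F; 4F; 5F)
open import Data.Fin.Properties using (_≟_; <-cmp; any?)
open import Data.List.Base as List
  using ( List; []; _∷_; length; map; reverse; reverseAcc; allFin; tabulate; upTo; downFrom
        ; applyUpTo; foldr; filterᵇ )
import Data.List.Membership.DecPropositional as DecMembership
open import Data.List.Membership.Propositional using (_∈_; _∉_)
open import Data.List.Membership.Propositional.Properties
  using (∈-map⁺; ∈-map⁻; ∈-filter⁺; ∈-filter⁻; ∈-allFin; ∈-lookup)
open import Data.List.Properties
  using ( map-tabulate; map-∘; reverse-upTo; reverse-map; reverse-involutive; tabulate-cong
        ; tabulate-lookup; length-tabulate; length-map; length-filter; length-reverse )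
open import Data.List.Relation.Binary.Permutation.Propositional using (↭-sym; ↭⇒↭ₛ)
open import Data.List.Relation.Binary.Permutation.Propositional.Properties using (↭-reverse)
import Data.List.Relation.Binary.Permutation.Setoid.Properties as Permutation
open import Data.List.Relation.Unary.All as All using (All; []; _∷_)
open import Data.List.Relation.Unary.All.Properties using (¬Any⇒All¬)
open import Data.List.Relation.Unary.AllPairs using ([]; _∷_)
open import Data.List.Relation.Unary.Any as Any using (here; there)
open import Data.List.Relation.Unary.Any.Properties using (reverse⁺; reverse⁻; lookup-index)
open import Data.List.Relation.Unary.Unique.Propositional using (Unique)
open import Data.List.Relation.Unary.Unique.Propositional.Properties using (allFin⁺)
open import Data.Nat.Base using (zero; suc; _+_; _*_; _<_; _≤ᵇ_; z≤n; s≤s; >-nonZero)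
open import Data.Nat.Properties hiding (_≟_; <-cmp)
open import Data.Nat.Tactic.RingSolver using (solve-∀)
open import Data.Product.Base using (∃-syntax; _,_; proj₁; proj₂)
open import Data.Sum.Base as Sum using (_⊎_; inj₁; inj₂; [_,_]′)
open import Data.Unit.Base using (tt)
open import Data.Vec.Base using (Vec; []; _∷_; lookup)
open import Function.Base using (_∘_; id; case_of_)
open import Function.Bundles using (mk⇔)
open import Relation.Binary.Definitions using (tri<; tri≈; tri>)
open import Relation.Binary.PropositionalEquality
  using (_≡_; _≢_; refl; trans; cong; cong₂; subst; subst₂; setoid; module ≡-Reasoning)
  renaming (sym to ≡-sym)
open import Relation.Nullary.Decidable.Core using (Dec; does; yes; no)
open import Relation.Nullary.Negation.Core using (¬_)

-- Polynomials

-- A graph is complete multipartite unless some edge `pq` misses a third vertex `r`. In a completion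
-- that adds no pair at a clean vertex and none between components, `p`, `q` and `r` in one
-- component are all unclean, since a clean vertex is a twin of each of its non-neighbours there. So
-- clean vertices never create an obstruction; one of them is kept so that the kept part of a
-- component stays connected. On the machine side, time and size bounds are proved for all input
-- trees, not for encodings alone. No bound then needs a well-formedness hypothesis, but every loop
-- needs a bound on the growth of its state that is valid for arbitrary trees. Folds that collect
-- results also reverse their list, which is the origin of the descending vertex lists.

infixl 6 _⊞_
infixl 7 _⊠_

data Poly : Set where
  con     : ℕ → Poly
  X       : Poly
  _⊞_ _⊠_ : Poly → Poly → Poly

⟪_⟫ : Poly → ℕ → ℕ
⟪ con c ⟫ n = c
⟪ X ⟫     n = n
⟪ p ⊞ q ⟫ n = ⟪ p ⟫ n + ⟪ q ⟫ n
⟪ p ⊠ q ⟫ n = ⟪ p ⟫ n * ⟪ q ⟫ n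

⟪_⟫-mono : ∀ p {m n} → m ≤ n → ⟪ p ⟫ m ≤ ⟪ p ⟫ n
⟪ con c ⟫-mono le = ≤-refl
⟪ X ⟫-mono     le = le
⟪ p ⊞ q ⟫-mono le = +-mono-≤ (⟪ p ⟫-mono le) (⟪ q ⟫-mono le)
⟪ p ⊠ q ⟫-mono le = *-mono-≤ (⟪ p ⟫-mono le) (⟪ q ⟫-mono le)

_⟦_⟧ₚ : Poly → Poly → Poly
con c   ⟦ r ⟧ₚ = con c
X       ⟦ r ⟧ₚ = r
(p ⊞ q) ⟦ r ⟧ₚ = (p ⟦ r ⟧ₚ) ⊞ (q ⟦ r ⟧ₚ)
(p ⊠ q) ⟦ r ⟧ₚ = (p ⟦ r ⟧ₚ) ⊠ (q ⟦ r ⟧ₚ)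

⟪⟫-substitute : ∀ p r n → ⟪ p ⟦ r ⟧ₚ ⟫ n ≡ ⟪ p ⟫ (⟪ r ⟫ n)
⟪⟫-substitute (con c) r n = refl
⟪⟫-substitute X       r n = refl
⟪⟫-substitute (p ⊞ q) r n = cong₂ _+_ (⟪⟫-substitute p r n) (⟪⟫-substitute q r n)
⟪⟫-substitute (p ⊠ q) r n = cong₂ _*_ (⟪⟫-substitute p r n) (⟪⟫-substitute q r n)

⟪_∘_⟫-bound : ∀ p r {m n} → m ≤ ⟪ r ⟫ n → ⟪ p ⟫ m ≤ ⟪ p ⟦ r ⟧ₚ ⟫ n
⟪ p ∘ r ⟫-bound {n = n} le =
  ≤-trans (⟪ p ⟫-mono le) (≤-reflexive (≡-sym (⟪⟫-substitute p r n)))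

-- Positivity of `n` allows both monomials of a sum to be raised to the common exponent `d + e`.
monomial-bound : ∀ p → ∃[ a ] ∃[ d ] (∀ n → 1 ≤ n → ⟪ p ⟫ n ≤ a * n ^ d)
monomial-bound (con c) = c , 0 , λ n _ → ≤-reflexive (≡-sym (*-identityʳ c))
monomial-bound X       = 1 , 1 , λ n _ →
  ≤-reflexive (≡-sym (trans (*-identityˡ (n ^ 1)) (^-identityʳ n)))
monomial-bound (p ⊞ q) with monomial-bound p | monomial-bound q
... | a , d , pa | b , e , qb = a + b , d + e , λ n n≥1 → begin
    ⟪ p ⟫ n + ⟪ q ⟫ n              ≤⟨ +-mono-≤ (pa n n≥1) (qb n n≥1) ⟩
    a * n ^ d + b * n ^ e          ≤⟨ +-mono-≤ (*-monoʳ-≤ a (^-monoʳ-≤ n ⦃ >-nonZero n≥1 ⦄ (m≤m+n d e)))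
                                               (*-monoʳ-≤ b (^-monoʳ-≤ n ⦃ >-nonZero n≥1 ⦄ (m≤n+m e d))) ⟩
    a * n ^ (d + e) + b * n ^ (d + e) ≡⟨ *-distribʳ-+ (n ^ (d + e)) a b ⟨
    (a + b) * n ^ (d + e)          ∎
  where open ≤-Reasoning
monomial-bound (p ⊠ q) with monomial-bound p | monomial-bound q
... | a , d , pa | b , e , qb = a * b , d + e , λ n n≥1 → begin
    ⟪ p ⟫ n * ⟪ q ⟫ n              ≤⟨ *-mono-≤ (pa n n≥1) (qb n n≥1) ⟩
    (a * n ^ d) * (b * n ^ e)      ≡⟨ *-interchange a (n ^ d) b (n ^ e) ⟩
    (a * b) * (n ^ d * n ^ e)      ≡⟨ cong (a * b *_) (^-distribˡ-+-* n d e) ⟨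
    (a * b) * n ^ (d + e)          ∎
  where
  open ≤-Reasoning
  *-interchange : ∀ a x b y → (a * x) * (b * y) ≡ (a * b) * (x * y)
  *-interchange = solve-∀

-- Tree functions compiled to WHILE programs

infixr 9 _⊙_

-- Functions of a single tree, so that composition needs no management of variables. The only loop
-- is `fold`, on arguments (context, (list, state)); the context gives each step access to the
-- surrounding data.
data Fun : Set where
  pure : Expr 1 → Fun
  both : Fun → Fun → Fun
  _⊙_  : Fun → Fun → Fun
  cond : Fun → Fun → Fun → Fun
  fold : Fun → Fun

mutual
  ⟦_⟧ : Fun → Tree → Tree
  ⟦ pure e ⟧     x = eval e (x ∷ [])
  ⟦ both f g ⟧   x = cons (⟦ f ⟧ x) (⟦ g ⟧ x)
  ⟦ f ⊙ g ⟧      x = ⟦ f ⟧ (⟦ g ⟧ x)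
  ⟦ cond p f g ⟧ x = branch (⟦ p ⟧ x) f g x
  ⟦ fold f ⟧     x = folded f (left x) (left (right x)) (right (right x))

  branch : Tree → Fun → Fun → Tree → Tree
  branch nil        f g x = ⟦ g ⟧ x
  branch (cons _ _) f g x = ⟦ f ⟧ x

  folded : Fun → Tree → Tree → Tree → Tree
  folded f c nil         s = s
  folded f c (cons y ys) s = folded f c ys (⟦ f ⟧ (cons c (cons y s)))

acc stack : ∀ {n} → Expr (2 + n)
acc   = var zero
stack = var (suc zero)

embed : Expr 1 → Expr 2
embed (var x)    = acc
embed nil        = nil
embed (cons e f) = cons (embed e) (embed f)
embed (hd e)     = hd (embed e)
embed (tl e)     = tl (embed e)

eval-embed : ∀ e x k → eval (embed e) (x ∷ k ∷ []) ≡ eval e (x ∷ [])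
eval-embed (var zero) x k = refl
eval-embed nil        x k = refl
eval-embed (cons e f) x k = cong₂ cons (eval-embed e x k) (eval-embed f x k)
eval-embed (hd e)     x k = cong left (eval-embed e x k)
eval-embed (tl e)     x k = cong right (eval-embed e x k)

push pop : Command 2
push = suc zero := cons acc stack
pop  = (zero := hd stack) ⨾ (suc zero := tl stack)

-- The context and the rest of the list wait on the stack while the step runs.
foldBody : Command 2 → Command 2
foldBody c =
    (suc zero := cons (cons (hd acc) (tl (hd (tl acc)))) stack)
  ⨾ (zero := cons (hd acc) (cons (hd (hd (tl acc))) (tl (tl acc))))
  ⨾ c
  ⨾ (zero := cons (hd (hd stack)) (cons (tl (hd stack)) acc))
  ⨾ (suc zero := tl stack)

compile : Fun → Command 2
compile (pure e)     = zero := embed e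
compile (both f g)   =
    push
  ⨾ compile f
  ⨾ push
  ⨾ (zero := hd (tl stack))
  ⨾ compile g
  ⨾ (zero := cons (hd stack) acc)
  ⨾ (suc zero := tl (tl stack))
compile (f ⊙ g)      = compile g ⨾ compile f
compile (cond p f g) =
    push
  ⨾ compile p
  ⨾ if acc then (pop ⨾ compile f) else (pop ⨾ compile g)
compile (fold f)     =
    -- This rebuilds the argument from explicit pairs, so that the loop invariant has the same shape
    -- on malformed inputs such as `nil`.
    (zero := cons (hd acc) (cons (hd (tl acc)) (tl (tl acc))))
  ⨾ (while hd (tl acc) loop foldBody (compile f))
  ⨾ (zero := tl (tl acc))

mutual
  -- The numerals are the costs of the assignments and tests in `compile`, bracketed as they are
  -- executed, so that `compile-correct` involves no arithmetic.
  time : Fun → Tree → ℕ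
  time (pure e)     x = 1 + cost (embed e)
  time (both f g)   x =
    4 + (time f x + (4 + (4 + (time g x + (5 + 4)))))
  time (f ⊙ g)      x = time g x + time f (⟦ g ⟧ x)
  time (cond p f g) x = 4 + (time p x + (2 + branchTime (⟦ p ⟧ x) f g x))
  time (fold f)     x =
    11 + (foldTime f (left x) (left (right x)) (right (right x)) + 4)

  branchTime : Tree → Fun → Fun → Tree → ℕ
  branchTime nil        f g x = 3 + 3 + time g x
  branchTime (cons _ _) f g x = 3 + 3 + time f x

  foldTime : Fun → Tree → Tree → Tree → ℕ
  foldTime f c nil         s = 4
  foldTime f c (cons y ys) s =
    4 + (10 + (12 + (time f (cons c (cons y s)) + (10 + 3))))
      + foldTime f c ys (⟦ f ⟧ (cons c (cons y s)))

mutual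
  -- The stack `k` is arbitrary and is handed back unchanged; this is what makes the claims for
  -- subprograms compose.
  compile-correct : ∀ f x k →
    compile f ⊢ x ∷ k ∷ [] ⇓ ⟦ f ⟧ x ∷ k ∷ [] [ time f x ]
  compile-correct (pure e) x k =
    subst (λ y → zero := embed e ⊢ x ∷ k ∷ [] ⇓ y ∷ k ∷ [] [ 1 + cost (embed e) ])
          (eval-embed e x k) assign
  compile-correct (both f g) x k =
    seq assign (seq (compile-correct f x _) (seq assign (seq assign
      (seq (compile-correct g x _) (seq assign assign)))))
  compile-correct (f ⊙ g) x k =
    seq (compile-correct g x k) (compile-correct f (⟦ g ⟧ x) k)
  compile-correct (cond p f g) x k =
    seq assign (seq (compile-correct p x _) (branch-correct (⟦ p ⟧ x) f g x k))
  compile-correct (fold f) x k =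
    seq assign (seq (fold-correct f (left x) (left (right x)) (right (right x)) k) assign)

  branch-correct : ∀ y f g x k →
    if acc then (pop ⨾ compile f) else (pop ⨾ compile g)
      ⊢ y ∷ cons x k ∷ [] ⇓ branch y f g x ∷ k ∷ [] [ 2 + branchTime y f g x ]
  branch-correct nil        f g x k =
    if-false refl (seq (seq assign assign) (compile-correct g x k))
  branch-correct (cons _ _) f g x k =
    if-true refl (seq (seq assign assign) (compile-correct f x k))

  fold-correct : ∀ f c ys s k →
    while hd (tl acc) loop foldBody (compile f)
      ⊢ cons c (cons ys s) ∷ k ∷ [] ⇓ cons c (cons nil (folded f c ys s)) ∷ k ∷ []
      [ foldTime f c ys s ]
  fold-correct f c nil         s k = while-false refl
  fold-correct f c (cons y ys) s k =
    while-true refl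
      (seq assign (seq assign (seq (compile-correct f _ _) (seq assign assign))))
      (fold-correct f c ys _ k)

-- Polynomially bounded tree functions

size≥1 : ∀ x → 1 ≤ size x
size≥1 nil        = s≤s z≤n
size≥1 (cons x y) = s≤s z≤n

size-left : ∀ x → size (left x) ≤ size x
size-left nil        = ≤-refl
size-left (cons x y) = m≤n⇒m≤1+n (m≤m+n (size x) (size y))

size-right : ∀ x → size (right x) ≤ size x
size-right nil        = ≤-refl
size-right (cons x y) = m≤n⇒m≤1+n (m≤n+m (size y) (size x))

size-eval : ∀ e x → size (eval e (x ∷ [])) ≤ cost e * size x
size-eval (var zero) x = ≤-reflexive (≡-sym (*-identityˡ (size x)))
size-eval nil        x = ≤-trans (size≥1 x) (≤-reflexive (≡-sym (*-identityˡ (size x))))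
size-eval (cons e f) x = begin
  1 + size (eval e _) + size (eval f _)             ≤⟨ +-mono-≤ (+-mono-≤ (size≥1 x) (size-eval e x)) (size-eval f x) ⟩
  size x + cost e * size x + cost f * size x        ≡⟨ *-distribʳ-+ (size x) (1 + cost e) (cost f) ⟨
  (1 + cost e + cost f) * size x                    ∎
  where open ≤-Reasoning
size-eval (hd e) x =
  ≤-trans (size-left (eval e _)) (≤-trans (size-eval e x) (m≤n+m _ (size x)))
size-eval (tl e) x =
  ≤-trans (size-right (eval e _)) (≤-trans (size-eval e x) (m≤n+m _ (size x)))

-- The size bound is carried along separately because trees are shared: a bound on the time does not
-- limit the size of the result polynomially.
record Feasible (f : Fun) : Set where
  field
    timeBound sizeBound : Poly
    time≤ : ∀ x → time f x ≤ ⟪ timeBound ⟫ (size x)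
    size≤ : ∀ x → size (⟦ f ⟧ x) ≤ ⟪ sizeBound ⟫ (size x)

open Feasible

feasible-pure : ∀ e → Feasible (pure e)
feasible-pure e = record
  { timeBound = con (1 + cost (embed e))
  ; sizeBound = con (cost e) ⊠ X
  ; time≤     = λ x → ≤-refl
  ; size≤     = size-eval e
  }

feasible-both : ∀ {f g} → Feasible f → Feasible g → Feasible (both f g)
feasible-both F G = record
  { timeBound = con 4 ⊞ (timeBound F ⊞ (con 8 ⊞ (timeBound G ⊞ con 9)))
  ; sizeBound = con 1 ⊞ sizeBound F ⊞ sizeBound G
  ; time≤     = λ x → +-monoʳ-≤ 4 (+-mono-≤ (time≤ F x) (+-monoʳ-≤ 8 (+-monoˡ-≤ 9 (time≤ G x))))
  ; size≤     = λ x → s≤s (+-mono-≤ (size≤ F x) (size≤ G x))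
  }

feasible-⊙ : ∀ {f g} → Feasible f → Feasible g → Feasible (f ⊙ g)
feasible-⊙ {f} {g} F G = record
  { timeBound = timeBound G ⊞ (timeBound F ⟦ sizeBound G ⟧ₚ)
  ; sizeBound = sizeBound F ⟦ sizeBound G ⟧ₚ
  ; time≤     = λ x → +-mono-≤ (time≤ G x)
                  (≤-trans (time≤ F (⟦ g ⟧ x)) (⟪ timeBound F ∘ sizeBound G ⟫-bound (size≤ G x)))
  ; size≤     = λ x → ≤-trans (size≤ F (⟦ g ⟧ x)) (⟪ sizeBound F ∘ sizeBound G ⟫-bound (size≤ G x))
  }

feasible-cond : ∀ {p f g} → Feasible p → Feasible f → Feasible g → Feasible (cond p f g)
feasible-cond {p} {f} {g} P F G = record
  { timeBound = con 4 ⊞ (timeBound P ⊞ (con 8 ⊞ (timeBound F ⊞ timeBound G)))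
  ; sizeBound = sizeBound F ⊞ sizeBound G
  ; time≤     = λ x → +-monoʳ-≤ 4 (+-mono-≤ (time≤ P x) (+-monoʳ-≤ 2 (branch-time (⟦ p ⟧ x) x)))
  ; size≤     = λ x → branch-size (⟦ p ⟧ x) x
  }
  where
  branch-time : ∀ y x →
    branchTime y f g x ≤ 6 + (⟪ timeBound F ⟫ (size x) + ⟪ timeBound G ⟫ (size x))
  branch-time nil        x = +-monoʳ-≤ 6 (≤-trans (time≤ G x) (m≤n+m _ _))
  branch-time (cons _ _) x = +-monoʳ-≤ 6 (≤-trans (time≤ F x) (m≤m+n _ _))

  branch-size : ∀ y x →
    size (branch y f g x) ≤ ⟪ sizeBound F ⟫ (size x) + ⟪ sizeBound G ⟫ (size x)
  branch-size nil        x = ≤-trans (size≤ G x) (m≤n+m _ _)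
  branch-size (cons _ _) x = ≤-trans (size≤ F x) (m≤m+n _ _)

-- The potential bounds the size of the state and does not increase along the
-- loop, so every intermediate state is polynomial in the input of the loop.
record Potential (f : Fun) : Set where
  field
    β       : Tree → Tree → Tree → ℕ
    size≤β  : ∀ c xs s → size s ≤ β c xs s
    descend : ∀ c y ys s → β c ys (⟦ f ⟧ (cons c (cons y s))) ≤ β c (cons y ys) s
    bound   : Poly
    β≤      : ∀ {c xs s n} → size c ≤ n → size xs ≤ n → size s ≤ n → β c xs s ≤ ⟪ bound ⟫ n

feasible-fold : ∀ {f} → Feasible f → Potential f → Feasible (fold f)
feasible-fold {f} F P = record
  -- 43 covers the 39 steps that an iteration spends outside `f`, and the substituted polynomial
  -- bounds the size of the argument `cons c (cons y s)`. The size of the list exceeds the number of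
  -- iterations, which pays for the final test.
  { timeBound = con 11 ⊞ (X ⊠ (con 43 ⊞ (timeBound F ⟦ con 2 ⊞ X ⊞ X ⊞ bound ⟧ₚ)) ⊞ con 4)
  ; sizeBound = bound
  ; time≤     = λ x → +-monoʳ-≤ 11 (+-monoˡ-≤ 4 (≤-trans
      (loop-time (size x) (⟪ bound ⟫ (size x)) (left x) (left (right x)) (right (right x))
        (size-left x) (size-l x) (β≤ (size-left x) (size-l x) (size-r x)))
      (*-mono-≤ (size-l x) (+-monoʳ-≤ 43 (≤-reflexive (≡-sym
        (⟪⟫-substitute (timeBound F) (con 2 ⊞ X ⊞ X ⊞ bound) (size x))))))))
  ; size≤     = λ x → ≤-trans (loop-size (left x) (left (right x)) (right (right x)))
                  (β≤ (size-left x) (size-l x) (size-r x))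
  }
  where
  open Potential P
  size-l : ∀ x → size (left (right x)) ≤ size x
  size-l x = ≤-trans (size-left (right x)) (size-right x)

  size-r : ∀ x → size (right (right x)) ≤ size x
  size-r x = ≤-trans (size-right (right x)) (size-right x)

  loop-size : ∀ c xs s → size (folded f c xs s) ≤ β c xs s
  loop-size c nil         s = size≤β c nil s
  loop-size c (cons y ys) s = ≤-trans (loop-size c ys _) (descend c y ys s)

  loop-time : ∀ n b c xs s → size c ≤ n → size xs ≤ n → β c xs s ≤ b →
    foldTime f c xs s ≤ size xs * (43 + ⟪ timeBound F ⟫ (2 + n + n + b))
  loop-time n b c nil         s c≤ xs≤ s≤ = s≤s (s≤s (s≤s (s≤s z≤n)))
  loop-time n b c (cons y ys) s c≤ xs≤ s≤ = begin
    4 + (10 + (12 + (time f arg + 13))) + foldTime f c ys _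
      ≤⟨ +-mono-≤ step (loop-time n b c ys _ c≤ (≤-trans (size-right (cons y ys)) xs≤)
                         (≤-trans (descend c y ys s) s≤)) ⟩
    w + size ys * w
      ≤⟨ +-monoʳ-≤ w (*-monoˡ-≤ w (m≤n+m (size ys) (size y))) ⟩
    w + (size y + size ys) * w ∎
    where
    open ≤-Reasoning
    arg = cons c (cons y s)
    w   = 43 + ⟪ timeBound F ⟫ (2 + n + n + b)
    arg-size : size arg ≤ 2 + n + n + b
    arg-size = begin
      1 + size c + (1 + size y + size s) ≡⟨ rearrange (size c) (size y) (size s) ⟩
      2 + size c + size y + size s
        ≤⟨ +-mono-≤ (+-mono-≤ (+-monoʳ-≤ 2 c≤) (≤-trans (size-left (cons y ys)) xs≤))
                    (≤-trans (size≤β c (cons y ys) s) s≤) ⟩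
      2 + n + n + b ∎
      where
      rearrange : ∀ i j k → 1 + i + (1 + j + k) ≡ 2 + i + j + k
      rearrange = solve-∀
    step : 4 + (10 + (12 + (time f arg + 13))) ≤ w
    step = begin
      26 + (time f arg + 13) ≡⟨ cong (26 +_) (+-comm (time f arg) 13) ⟩
      39 + time f arg        ≤⟨ +-mono-≤ (m≤m+n 39 4) (≤-trans (time≤ F arg) (⟪ timeBound F ⟫-mono arg-size)) ⟩
      w                      ∎

-- When a step adds an amount independent of the state, the amounts sum up instead of compounding;
-- the size of the remaining list bounds the number of steps to come.
additive : ∀ {f} (q : Poly) →
  (∀ c y s → size (⟦ f ⟧ (cons c (cons y s))) ≤ size s + ⟪ q ⟫ (size c + size y)) →
  Potential f
additive {f} q grow = record
  { β       = λ c xs s → size s + size xs * ⟪ q ⟫ (size c + size xs)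
  ; size≤β  = λ c xs s → m≤m+n _ _
  ; descend = descend
  ; bound   = X ⊞ X ⊠ (q ⟦ X ⊞ X ⟧ₚ)
  ; β≤      = λ c≤ xs≤ s≤ → +-mono-≤ s≤ (*-mono-≤ xs≤ (⟪ q ∘ X ⊞ X ⟫-bound (+-mono-≤ c≤ xs≤)))
  }
  where
  descend : ∀ c y ys s → _
  descend c y ys s = begin
    size (⟦ f ⟧ (cons c (cons y s))) + size ys * ⟪ q ⟫ (size c + size ys)
      ≤⟨ +-mono-≤ (≤-trans (grow c y s) (+-monoʳ-≤ (size s)
           (⟪ q ⟫-mono (+-monoʳ-≤ (size c) (size-left (cons y ys))))))
         (*-monoʳ-≤ (size ys) (⟪ q ⟫-mono (+-monoʳ-≤ (size c) (size-right (cons y ys))))) ⟩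
    size s + w + size ys * w   ≡⟨ +-assoc (size s) w _ ⟩
    size s + (w + size ys * w) ≤⟨ +-monoʳ-≤ (size s) (+-monoʳ-≤ w (*-monoˡ-≤ w (m≤n+m (size ys) (size y)))) ⟩
    size s + (w + (size y + size ys) * w) ∎
    where
    open ≤-Reasoning
    w = ⟪ q ⟫ (size c + size (cons y ys))

feasible⇒polynomialTime : ∀ {X Y : Set} (encX : X → Tree) (encY : Y → Tree) {f : X → Y} {F} →
  Feasible F → (∀ x → ⟦ F ⟧ (encX x) ≡ encY (f x)) → PolynomialTime encX encY f
feasible⇒polynomialTime encX encY {f} {F} feas correct
  with monomial-bound (timeBound feas ⊞ sizeBound feas)
... | a , d , dominated = 1 , compile F , a , d , λ x →
    time F (encX x)
  , (⟦ F ⟧ (encX x) ∷ nil ∷ [] , compile-correct F (encX x) nil , correct x)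
  , (begin
       time F (encX x) + size (encY (f x))
         ≡⟨ cong (λ y → time F (encX x) + size y) (correct x) ⟨
       time F (encX x) + size (⟦ F ⟧ (encX x))
         ≤⟨ +-mono-≤ (time≤ feas (encX x)) (size≤ feas (encX x)) ⟩
       ⟪ timeBound feas ⊞ sizeBound feas ⟫ (size (encX x))
         ≤⟨ dominated _ (size≥1 (encX x)) ⟩
       a * size (encX x) ^ d ∎)
  where open ≤-Reasoning

-- Access to encoded lists and unary numbers

x₀ : Expr 1
x₀ = var zero

drops : ℕ → Tree → Tree
drops zero    t = t
drops (suc i) t = drops i (right t)

drops-+ : ∀ i j t → drops (i + j) t ≡ drops j (drops i t)
drops-+ zero    j t = refl
drops-+ (suc i) j t = drops-+ i j (right t)

tls : ℕ → Expr 1 → Expr 1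
tls zero    e = e
tls (suc i) e = tls i (tl e)

eval-tls : ∀ i e s → eval (tls i e) s ≡ drops i (eval e s)
eval-tls zero    e s = refl
eval-tls (suc i) e s = eval-tls i (tl e) s

-- The body of a fold is run on the tree (context, (element, state)).
context element state : Expr 1
context = hd x₀
element = hd (tl x₀)
state   = tl (tl x₀)

trueₑ : Expr 1
trueₑ = cons nil nil

truth : Fun → Fun
truth f = cond f (pure trueₑ) (pure nil)

truth-correct : ∀ f {b} x → ⟦ f ⟧ x ≡ encodeBool b → ⟦ truth f ⟧ x ≡ encodeBool b
truth-correct f {false} x eq rewrite eq = refl
truth-correct f {true}  x eq rewrite eq = refl

size-branch : ∀ y f g x {n} → size (⟦ f ⟧ x) ≤ n → size (⟦ g ⟧ x) ≤ n →
  size (branch y f g x) ≤ n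
size-branch nil        f g x f≤ g≤ = g≤
size-branch (cons _ _) f g x f≤ g≤ = f≤

size-truth : ∀ f x → size (⟦ truth f ⟧ x) ≤ 3
size-truth f x = size-branch (⟦ f ⟧ x) (pure trueₑ) (pure nil) x ≤-refl (s≤s z≤n)

feasible-truth : ∀ {f} → Feasible f → Feasible (truth f)
feasible-truth F = feasible-cond F (feasible-pure _) (feasible-pure _)

-- One operation serves for indexing a list, for truncated subtraction of unary numbers and for
-- comparing the length of a list with a number.
dropFun : Fun
dropFun = fold (pure (tl state)) ⊙ pure (cons nil x₀)

drop-correct : ∀ i t → ⟦ dropFun ⟧ (cons (encodeℕ i) t) ≡ drops i t
drop-correct zero    t = refl
drop-correct (suc i) t = drop-correct i (right t)

feasible-drop : Feasible dropFun
feasible-drop = feasible-⊙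
  (feasible-fold (feasible-pure _)
    (additive (con 0) λ c y s → ≤-trans (size-right s) (m≤m+n (size s) 0)))
  (feasible-pure _)

-- An arbitrary tree stands in place of the number, because growth bounds of loops are required on
-- all inputs.
size-drop : ∀ i t → size (⟦ dropFun ⟧ (cons i t)) ≤ size t
size-drop nil        t = ≤-refl
size-drop (cons i j) t = ≤-trans (size-drop j (right t)) (size-right t)

nth : ∀ {n} (f : Fin n → Tree) i → left (drops (toℕ i) (encodeList (tabulate f))) ≡ f i
nth f zero    = refl
nth f (suc i) = nth (f ∘ suc) i

-- Finite relational structures and formulas over them

count : {A : Set} → (A → Bool) → List A → ℕ
count p []       = 0
count p (x ∷ xs) = ifᵇ p x then suc (count p xs) else count p xs

Rel : ℕ → Set
Rel n = Fin n → Fin n → Bool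

-- Quantifiers range over the domain, which may omit some of the n vertices.
record Structure (n m : ℕ) : Set where
  constructor structure
  field
    domain    : List (Fin n)
    bound     : ℕ
    relations : Vec (Rel n) m

open Structure

infixr 6 _∧ᶠ_
infixr 5 _∨ᶠ_

-- Variables are de Bruijn indices. The threshold of `fewᶠ` is twice the bound, the greatest number
-- of endpoints of `k` added edges.
data Formula (m : ℕ) : ℕ → Set where
  rel       : ∀ {j} → Fin m → Fin j → Fin j → Formula m j
  _∧ᶠ_ _∨ᶠ_ : ∀ {j} → Formula m j → Formula m j → Formula m j
  ¬ᶠ_       : ∀ {j} → Formula m j → Formula m j
  ∃ᶠ_       : ∀ {j} → Formula m (suc j) → Formula m j
  fewᶠ_      : ∀ {j} → Formula m (suc j) → Formula m j

sat : ∀ {n m j} → Formula m j → Structure n m → Vec (Fin n) j → Bool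
sat (rel r i k) A ρ = lookup (relations A) r (lookup ρ i) (lookup ρ k)
sat (φ ∧ᶠ ψ)    A ρ = sat φ A ρ ∧ sat ψ A ρ
sat (φ ∨ᶠ ψ)    A ρ = sat φ A ρ ∨ sat ψ A ρ
sat (¬ᶠ φ)      A ρ = not (sat φ A ρ)
sat (∃ᶠ φ)      A ρ = any (λ u → sat φ A (u ∷ ρ)) (domain A)
sat (fewᶠ φ)     A ρ = count (λ u → sat φ A (u ∷ ρ)) (domain A) ≤ᵇ bound A + bound A

encodeVertex : ∀ {n} → Fin n → Tree
encodeVertex u = encodeℕ (toℕ u)

encodeRel : ∀ {n} → Rel n → Tree
encodeRel R =
  encodeList (tabulate λ u → encodeList (tabulate λ v → encodeBool (R u v)))

encodeRels : ∀ {n m} → Vec (Rel n) m → Tree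
encodeRels []       = nil
encodeRels (R ∷ Rs) = cons (encodeRel R) (encodeRels Rs)

encodeStructure : ∀ {n m} → Structure n m → Tree
encodeStructure A =
  cons (encodeList (map encodeVertex (domain A)))
    (cons (encodeℕ (bound A)) (encodeRels (relations A)))

-- With the variables in front, a quantifier only conses its element onto the environment, and the
-- fields of the structure lie `j` tails deep.
encodeEnv : ∀ {n m j} → Structure n m → Vec (Fin n) j → Tree
encodeEnv A []      = encodeStructure A
encodeEnv A (u ∷ ρ) = cons (encodeVertex u) (encodeEnv A ρ)

variableₑ domainₑ boundₑ : ℕ → Expr 1
variableₑ i = hd (tls i x₀)
domainₑ   j = hd (tls j x₀)
boundₑ    j = hd (tls (1 + j) x₀)

relationₑ : ℕ → ℕ → Expr 1
relationₑ j r = hd (tls (2 + r + j) x₀)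

module _ {n m : ℕ} (A : Structure n m) where

  drops-env : ∀ {j} (ρ : Vec (Fin n) j) i → drops (j + i) (encodeEnv A ρ) ≡ drops i (encodeStructure A)
  drops-env []      i = refl
  drops-env (u ∷ ρ) i = drops-env ρ i

  tls-env : ∀ {j} (ρ : Vec (Fin n) j) i →
    eval (tls (i + j) x₀) (encodeEnv A ρ ∷ []) ≡ drops i (encodeStructure A)
  tls-env {j} ρ i = trans (eval-tls (i + j) x₀ _)
    (trans (cong (λ k → drops k (encodeEnv A ρ)) (+-comm i j)) (drops-env ρ i))

  variable-correct : ∀ {j} (ρ : Vec (Fin n) j) i →
    eval (variableₑ (toℕ i)) (encodeEnv A ρ ∷ []) ≡ encodeVertex (lookup ρ i)
  variable-correct ρ i = trans (cong left (eval-tls (toℕ i) x₀ _)) (go ρ i)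
    where
    go : ∀ {j} (ρ : Vec (Fin n) j) i →
      left (drops (toℕ i) (encodeEnv A ρ)) ≡ encodeVertex (lookup ρ i)
    go (u ∷ ρ) zero    = refl
    go (u ∷ ρ) (suc i) = go ρ i

  domain-correct : ∀ {j} (ρ : Vec (Fin n) j) →
    eval (domainₑ j) (encodeEnv A ρ ∷ []) ≡ encodeList (map encodeVertex (domain A))
  domain-correct ρ = cong left (tls-env ρ 0)

  bound-correct : ∀ {j} (ρ : Vec (Fin n) j) →
    eval (boundₑ j) (encodeEnv A ρ ∷ []) ≡ encodeℕ (bound A)
  bound-correct ρ = cong left (tls-env ρ 1)

  relation-correct : ∀ {j} (ρ : Vec (Fin n) j) r →
    eval (relationₑ j (toℕ r)) (encodeEnv A ρ ∷ []) ≡ encodeRel (lookup (relations A) r)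
  relation-correct ρ r = trans (cong left (tls-env ρ (2 + toℕ r))) (go (relations A) r)
    where
    go : ∀ {m} (Rs : Vec (Rel n) m) r →
      left (drops (toℕ r) (encodeRels Rs)) ≡ encodeRel (lookup Rs r)
    go (R ∷ Rs) zero    = refl
    go (R ∷ Rs) (suc r) = go Rs r

-- Model checking

extend : Expr 1
extend = cons element context

overDomain : ℕ → Fun → Fun
overDomain j f = fold f ⊙ pure (cons x₀ (cons (domainₑ j) nil))

existsBody countBody : Fun → Fun
existsBody f = cond (pure state) (pure trueₑ) (truth f ⊙ pure extend)
countBody  f = cond (f ⊙ pure extend) (pure (cons nil state)) (pure state)

-- On a unary count the result is `nil` exactly when the count is at most twice the bound.
dropTwice : ℕ → Fun → Fun
dropTwice j f = dropFun ⊙ both (pure (boundₑ j)) (dropFun ⊙ both (pure (boundₑ j)) f)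

program : ∀ {m j} → Formula m j → Fun
program {j = j} (rel r i k) =
  pure (hd x₀) ⊙ dropFun ⊙ both (pure (variableₑ (toℕ k)))
    (pure (hd x₀) ⊙ dropFun ⊙ both (pure (variableₑ (toℕ i))) (pure (relationₑ j (toℕ r))))
program (φ ∧ᶠ ψ) = cond (program φ) (program ψ) (pure nil)
program (φ ∨ᶠ ψ) = cond (program φ) (pure trueₑ) (program ψ)
program (¬ᶠ φ)   = cond (program φ) (pure nil) (pure trueₑ)
program {j = j} (∃ᶠ φ)  = overDomain j (existsBody (program φ))
program {j = j} (fewᶠ φ) =
  cond (dropTwice j (overDomain j (countBody (program φ)))) (pure nil) (pure trueₑ)

feasible-overDomain : ∀ {f} j → Feasible f → Potential f → Feasible (overDomain j f)
feasible-overDomain j F P = feasible-⊙ (feasible-fold F P) (feasible-pure _)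

feasible-program : ∀ {m j} (φ : Formula m j) → Feasible (program φ)
feasible-program (rel r i k) =
  feasible-⊙ (feasible-pure _) (feasible-⊙ feasible-drop (feasible-both (feasible-pure _)
    (feasible-⊙ (feasible-pure _) (feasible-⊙ feasible-drop
      (feasible-both (feasible-pure _) (feasible-pure _))))))
feasible-program (φ ∧ᶠ ψ) = feasible-cond (feasible-program φ) (feasible-program ψ) (feasible-pure _)
feasible-program (φ ∨ᶠ ψ) = feasible-cond (feasible-program φ) (feasible-pure _) (feasible-program ψ)
feasible-program (¬ᶠ φ)   = feasible-cond (feasible-program φ) (feasible-pure _) (feasible-pure _)
feasible-program {j = j} (∃ᶠ φ) = feasible-overDomain j
  (feasible-cond (feasible-pure _) (feasible-pure _)
    (feasible-⊙ (feasible-truth (feasible-program φ)) (feasible-pure _)))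
  (additive (con 3) λ c y s → ≤-trans
    (size-branch s (pure trueₑ) (truth (program φ) ⊙ pure extend) _ ≤-refl (size-truth (program φ) _))
    (m≤n+m 3 (size s)))
feasible-program {j = j} (fewᶠ φ) = feasible-cond
  (feasible-⊙ feasible-drop (feasible-both (feasible-pure _)
    (feasible-⊙ feasible-drop (feasible-both (feasible-pure _)
      (feasible-overDomain j
        (feasible-cond (feasible-⊙ (feasible-program φ) (feasible-pure _)) (feasible-pure _) (feasible-pure _))
        (additive (con 2) λ c y s → size-branch (⟦ program φ ⟧ (cons y c)) (pure (cons nil state)) (pure state) _
          (≤-reflexive (+-comm 2 (size s))) (m≤m+n (size s) 2)))))))
  (feasible-pure _) (feasible-pure _)

-- A nonempty remainder means that `c` is larger, hence the exchange of the branches. The extra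
-- split on `suc zero` follows `_≤ᵇ_`, which becomes the strict test after one successor.
≤ᵇ-drops : ∀ c d f g x → branch (drops d (encodeℕ c)) f g x ≡ branch (encodeBool (c ≤ᵇ d)) g f x
≤ᵇ-drops zero    zero    f g x = refl
≤ᵇ-drops zero    (suc d) f g x = ≤ᵇ-drops zero d f g x
≤ᵇ-drops (suc c) zero    f g x = refl
≤ᵇ-drops (suc zero)    (suc d) f g x = ≤ᵇ-drops zero d f g x
≤ᵇ-drops (suc (suc c)) (suc d) f g x = ≤ᵇ-drops (suc c) d f g x

module _ {n m : ℕ} (A : Structure n m) where

  overDomain-correct : ∀ {j} f (ρ : Vec (Fin n) j) →
    ⟦ overDomain j f ⟧ (encodeEnv A ρ) ≡
    folded f (encodeEnv A ρ) (encodeList (map encodeVertex (domain A))) nil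
  overDomain-correct f ρ = cong (λ xs → folded f (encodeEnv A ρ) xs nil) (domain-correct A ρ)

  program-correct : ∀ {j} (φ : Formula m j) ρ →
    ⟦ program φ ⟧ (encodeEnv A ρ) ≡ encodeBool (sat φ A ρ)

  count-correct : ∀ {j} (φ : Formula m (suc j)) ρ a us →
    folded (countBody (program φ)) (encodeEnv A ρ) (encodeList (map encodeVertex us)) (encodeℕ a)
      ≡ encodeℕ (count (λ u → sat φ A (u ∷ ρ)) us + a)

  program-correct (rel r i k) ρ
    rewrite variable-correct A ρ i | variable-correct A ρ k | relation-correct A ρ r
          | drop-correct (toℕ (lookup ρ i)) (encodeRel (lookup (relations A) r))
          | nth (λ u → encodeList (tabulate λ v → encodeBool (lookup (relations A) r u v))) (lookup ρ i)
          | drop-correct (toℕ (lookup ρ k))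
              (encodeList (tabulate λ v → encodeBool (lookup (relations A) r (lookup ρ i) v)))
    = nth (λ v → encodeBool (lookup (relations A) r (lookup ρ i) v)) (lookup ρ k)
  program-correct (φ ∧ᶠ ψ) ρ rewrite program-correct φ ρ with sat φ A ρ
  ... | true  = program-correct ψ ρ
  ... | false = refl
  program-correct (φ ∨ᶠ ψ) ρ rewrite program-correct φ ρ with sat φ A ρ
  ... | true  = refl
  ... | false = program-correct ψ ρ
  program-correct (¬ᶠ φ) ρ rewrite program-correct φ ρ with sat φ A ρ
  ... | true  = refl
  ... | false = refl
  program-correct (∃ᶠ φ) ρ =
    trans (overDomain-correct (existsBody (program φ)) ρ) (go false (domain A))
    where
    go : ∀ b us →
      folded (existsBody (program φ)) (encodeEnv A ρ) (encodeList (map encodeVertex us)) (encodeBool b)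
        ≡ encodeBool (b ∨ any (λ u → sat φ A (u ∷ ρ)) us)
    go false []       = refl
    go true  []       = refl
    go true  (u ∷ us) = go true us
    go false (u ∷ us)
      rewrite truth-correct (program φ) (encodeEnv A (u ∷ ρ)) (program-correct φ (u ∷ ρ)) =
      go (sat φ A (u ∷ ρ)) us
  program-correct {j} (fewᶠ φ) ρ
    rewrite overDomain-correct (countBody (program φ)) ρ | count-correct φ ρ 0 (domain A)
          | bound-correct A ρ
          | drop-correct (bound A) (encodeℕ (count (λ u → sat φ A (u ∷ ρ)) (domain A) + 0))
          | drop-correct (bound A) (drops (bound A) (encodeℕ (count (λ u → sat φ A (u ∷ ρ)) (domain A) + 0)))
          | ≡-sym (drops-+ (bound A) (bound A) (encodeℕ (count (λ u → sat φ A (u ∷ ρ)) (domain A) + 0)))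
          | +-identityʳ (count (λ u → sat φ A (u ∷ ρ)) (domain A))
          | ≤ᵇ-drops (count (λ u → sat φ A (u ∷ ρ)) (domain A)) (bound A + bound A)
              (pure nil) (pure trueₑ) (encodeEnv A ρ)
    with count (λ u → sat φ A (u ∷ ρ)) (domain A) ≤ᵇ bound A + bound A
  ... | true  = refl
  ... | false = refl

  count-correct φ ρ a []       = refl
  count-correct φ ρ a (u ∷ us) rewrite program-correct φ (u ∷ ρ) with sat φ A (u ∷ ρ)
  ... | true  = trans (count-correct φ ρ (suc a) us) (cong encodeℕ (+-suc _ a))
  ... | false = count-correct φ ρ a us

-- Tabulation of definable relations

collect : ℕ → Fun → Fun
collect j g = overDomain j (both (g ⊙ pure extend) (pure state))

define : ∀ {m} j → Formula m (2 + j) → Fun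
define j φ = collect j (collect (1 + j) (truth (program φ)))

feasible-collect : ∀ {g} j → Feasible g → Feasible (collect j g)
feasible-collect {g} j G = feasible-overDomain j
  (feasible-both (feasible-⊙ G (feasible-pure _)) (feasible-pure _))
  (additive (con 1 ⊞ (sizeBound G ⟦ con 1 ⊞ X ⟧ₚ)) λ c y s → begin
    1 + size (⟦ g ⟧ (cons y c)) + size s ≡⟨ +-comm _ (size s) ⟩
    size s + (1 + size (⟦ g ⟧ (cons y c)))
      ≤⟨ +-monoʳ-≤ (size s) (s≤s (≤-trans (size≤ G (cons y c))
           (⟪ sizeBound G ∘ con 1 ⊞ X ⟫-bound (s≤s (≤-reflexive (+-comm (size y) (size c))))))) ⟩
    size s + (1 + ⟪ sizeBound G ⟦ con 1 ⊞ X ⟧ₚ ⟫ (size c + size y)) ∎)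
  where open ≤-Reasoning

feasible-define : ∀ {m} j (φ : Formula m (2 + j)) → Feasible (define j φ)
feasible-define j φ =
  feasible-collect j (feasible-collect (1 + j) (feasible-truth (feasible-program φ)))

-- The bound involves the domain and the entries but not the relations stored in `e`. Without this,
-- the bounds would compound when Warshall's algorithm tabulates repeatedly.
size-collect : ∀ j g e {b} → (∀ y → size (⟦ g ⟧ (cons y e)) ≤ b) →
  size (⟦ collect j g ⟧ e) ≤ 1 + size (eval (domainₑ j) (e ∷ [])) * (1 + b)
size-collect j g e {b} g≤ = ≤-trans (go (eval (domainₑ j) (e ∷ [])) nil) ≤-refl
  where
  open ≤-Reasoning
  body = both (g ⊙ pure extend) (pure state)
  go : ∀ xs s → size (folded body e xs s) ≤ size s + size xs * (1 + b)
  go nil         s = m≤m+n (size s) _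
  go (cons y ys) s = begin
    size (folded body e ys (cons (⟦ g ⟧ (cons y e)) s))
      ≤⟨ go ys _ ⟩
    1 + size (⟦ g ⟧ (cons y e)) + size s + size ys * (1 + b)
      ≤⟨ +-monoˡ-≤ _ (s≤s (+-monoˡ-≤ (size s) (g≤ y))) ⟩
    1 + b + size s + size ys * (1 + b)
      ≡⟨ rearrange (1 + b) (size s) (size ys) ⟩
    size s + (1 + size ys) * (1 + b)
      ≤⟨ +-monoʳ-≤ (size s) (*-monoˡ-≤ (1 + b) (s≤s (m≤n+m (size ys) (size y)))) ⟩
    size s + size (cons y ys) * (1 + b) ∎
    where
    rearrange : ∀ w s t → w + s + t * w ≡ s + (1 + t) * w
    rearrange = solve-∀

module _ {n m : ℕ} (A : Structure n m) where

  collect-correct : ∀ {j} g (ρ : Vec (Fin n) j) {h : Fin n → Tree} →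
    (∀ u → ⟦ g ⟧ (encodeEnv A (u ∷ ρ)) ≡ h u) →
    ⟦ collect j g ⟧ (encodeEnv A ρ) ≡ encodeList (map h (reverse (domain A)))
  collect-correct g ρ {h} correct = trans (overDomain-correct A _ ρ) (go [] (domain A))
    where
    go : ∀ ts us →
      folded (both (g ⊙ pure extend) (pure state)) (encodeEnv A ρ)
        (encodeList (map encodeVertex us)) (encodeList (map h ts))
      ≡ encodeList (map h (reverseAcc ts us))
    go ts []       = refl
    go ts (u ∷ us) rewrite correct u = go (u ∷ ts) us

  define-correct : ∀ {j} (φ : Formula m (2 + j)) (ρ : Vec (Fin n) j) →
    ⟦ define j φ ⟧ (encodeEnv A ρ) ≡
      encodeList (map (λ u → encodeList (map (λ v → encodeBool (sat φ A (v ∷ u ∷ ρ)))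
        (reverse (domain A)))) (reverse (domain A)))
  define-correct {j} φ ρ = collect-correct (collect (1 + j) (truth (program φ))) ρ λ u →
    collect-correct (truth (program φ)) (u ∷ ρ) λ v →
      truth-correct (program φ) _ (program-correct A φ (v ∷ u ∷ ρ))

-- Descending, because `collect` reverses: tabulation over this list yields rows and columns in
-- ascending order, as in `encodeRel`.
allVertices : ∀ n → List (Fin n)
allVertices n = reverse (allFin n)

defined : ∀ {n m j} → Formula m (2 + j) → Structure n m → Vec (Fin n) j → Rel n
defined φ A ρ u v = sat φ A (v ∷ u ∷ ρ)

define-total : ∀ {n m j} k (Rs : Vec (Rel n) m) (φ : Formula m (2 + j)) ρ →
  ⟦ define j φ ⟧ (encodeEnv (structure (allVertices n) k Rs) ρ)
    ≡ encodeRel (defined φ (structure (allVertices n) k Rs) ρ)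
define-total {n} k Rs φ ρ = begin
  ⟦ define _ φ ⟧ (encodeEnv A ρ) ≡⟨ define-correct A φ ρ ⟩
  encodeList (map (λ u → encodeList (map (cell u) vs)) vs)
    ≡⟨ cong (λ us → encodeList (map (λ u → encodeList (map (cell u) us)) us)) (reverse-involutive (allFin n)) ⟩
  encodeList (map (λ u → encodeList (map (cell u) (allFin n))) (allFin n))
    ≡⟨ cong encodeList (map-tabulate id (λ u → encodeList (map (cell u) (allFin n)))) ⟩
  encodeList (tabulate λ u → encodeList (map (cell u) (allFin n)))
    ≡⟨ cong encodeList (tabulate-cong λ u → cong encodeList (map-tabulate id (cell u))) ⟩
  encodeRel (defined φ A ρ) ∎
  where
  open ≡-Reasoning
  A = structure (allVertices n) k Rs
  vs = reverse (allVertices n)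
  cell : Fin n → Fin n → Tree
  cell u v = encodeBool (sat φ A (v ∷ u ∷ ρ))

expand : ∀ {n m} → Formula m 2 → Structure n m → Structure n (suc m)
expand φ A = structure (domain A) (bound A) (defined φ A [] ∷ relations A)

expandFun : ∀ {m} → Formula m 2 → Fun
expandFun φ = both (pure (hd x₀)) (both (pure (hd (tl x₀))) (both (define 0 φ) (pure (tl (tl x₀)))))

feasible-expand : ∀ {m} (φ : Formula m 2) → Feasible (expandFun φ)
feasible-expand φ = feasible-both (feasible-pure _)
  (feasible-both (feasible-pure _) (feasible-both (feasible-define 0 φ) (feasible-pure _)))

expand-correct : ∀ {n m} k (Rs : Vec (Rel n) m) (φ : Formula m 2) →
  ⟦ expandFun φ ⟧ (encodeStructure (structure (allVertices n) k Rs))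
    ≡ encodeStructure (expand φ (structure (allVertices n) k Rs))
expand-correct k Rs φ =
  cong (λ R → cons _ (cons _ (cons R _))) (define-total k Rs φ [])

-- Transitive closure by Warshall's algorithm

via : ∀ {n} → Fin n → Rel n → Rel n
via w R u v = R u v ∨ (R u w ∧ R w v)

warshall : ∀ {n} → List (Fin n) → Rel n → Rel n
warshall []       R = R
warshall (w ∷ ws) R = warshall ws (via w R)

viaᶠ : Formula 1 3
viaᶠ = rel 0F 1F 0F ∨ᶠ (rel 0F 1F 2F ∧ᶠ rel 0F 2F 0F)

warshallBody : Fun
warshallBody = define 1 viaᶠ ⊙
  pure (cons element (cons (hd context) (cons (tl context) (cons state nil))))

warshallFun : Fun
warshallFun = fold warshallBody ⊙
  pure (cons (cons (hd x₀) (hd (tl x₀))) (cons (hd x₀) (hd (tl (tl x₀)))))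

feasible-warshall : Feasible warshallFun
feasible-warshall = feasible-⊙
  (feasible-fold (feasible-⊙ (feasible-define 1 viaᶠ) (feasible-pure _))
    (additive matrix λ c y s → ≤-trans
      (size-collect 1 (collect 2 (truth (program viaᶠ))) (environment c y s) λ u →
        size-collect 2 (truth (program viaᶠ)) (cons u (environment c y s)) λ v →
          size-truth (program viaᶠ) (cons v (cons u (environment c y s))))
      (≤-trans (⟪ matrix ⟫-mono (≤-trans (size-left c) (m≤m+n (size c) (size y))))
        (m≤n+m _ (size s)))))
  (feasible-pure _)
  where
  environment : Tree → Tree → Tree → Tree
  environment c y s = cons y (cons (left c) (cons (right c) (cons s nil)))
  matrix : Poly
  -- An entry has size at most 3 and its list cell adds 1, whence the 4.
  matrix = con 1 ⊞ X ⊠ (con 1 ⊞ (con 1 ⊞ X ⊠ con 4))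

warshall-correct : ∀ {n} k (R : Rel n) →
  ⟦ warshallFun ⟧ (encodeStructure (structure (allVertices n) k (R ∷ [])))
    ≡ encodeRel (warshall (allVertices n) R)
warshall-correct {n} k R = go (allVertices n) R
  where
  c = cons (encodeList (map encodeVertex (allVertices n))) (encodeℕ k)
  go : ∀ (ws : List (Fin n)) (R : Rel n) →
    folded warshallBody c (encodeList (map encodeVertex ws)) (encodeRel R)
    ≡ encodeRel (warshall ws R)
  go []       R = refl
  go (w ∷ ws) R = trans
    (cong (folded warshallBody c (encodeList (map encodeVertex ws)))
      (define-total k (R ∷ []) viaᶠ (w ∷ [])))
    (go ws (via w R))

-- Greedy selection by a formula

module _ {m : ℕ} (φ : Formula m 1) where

  -- The domain is the list of vertices selected so far: the quantifiers of `φ` see only these,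
  -- while the relations still describe the whole graph.
  greedyStep : ∀ {n} → ℕ → Vec (Rel n) m → Fin n → List (Fin n) → List (Fin n)
  greedyStep k Rs u S = ifᵇ sat φ (structure S k Rs) (u ∷ []) then u ∷ S else S

  greedy : ∀ {n} → ℕ → Vec (Rel n) m → List (Fin n) → List (Fin n)
  greedy k Rs = foldr (greedyStep k Rs) []

  greedyBody greedyFun : Fun
  greedyBody = cond (program φ ⊙ pure (cons element (cons state context)))
                    (pure (cons element state)) (pure state)
  greedyFun  = fold greedyBody ⊙ pure (cons (tl x₀) (cons (hd x₀) nil))

  feasible-greedy : Feasible greedyFun
  feasible-greedy = feasible-⊙
    (feasible-fold
      (feasible-cond (feasible-⊙ (feasible-program φ) (feasible-pure _)) (feasible-pure _) (feasible-pure _))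
      (additive (con 1 ⊞ X) λ c y s →
        size-branch (⟦ program φ ⟧ (cons y (cons s c))) (pure (cons element state)) (pure state) _
          (≤-trans (≤-reflexive (+-comm (1 + size y) (size s)))
            (+-monoʳ-≤ (size s) (s≤s (m≤n+m (size y) (size c)))))
          (m≤m+n (size s) _)))
    (feasible-pure _)

  greedy-correct : ∀ {n} k (Rs : Vec (Rel n) m) →
    ⟦ greedyFun ⟧ (encodeStructure (structure (allVertices n) k Rs))
      ≡ encodeList (map encodeVertex (greedy k Rs (allFin n)))
  greedy-correct {n} k Rs = trans (go [] (allVertices n))
    (cong (λ us → encodeList (map encodeVertex (greedy k Rs us))) (reverse-involutive (allFin n)))
    where
    c = cons (encodeℕ k) (encodeRels Rs)
    go : ∀ us ws →
      folded greedyBody c (encodeList (map encodeVertex ws)) (encodeList (map encodeVertex (greedy k Rs us)))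
        ≡ encodeList (map encodeVertex (greedy k Rs (reverseAcc us ws)))
    go us []       = refl
    go us (w ∷ ws) = trans
      (cong (folded greedyBody c (encodeList (map encodeVertex ws))) step) (go (w ∷ us) ws)
      where
      S = greedy k Rs us
      step : ⟦ greedyBody ⟧ (cons c (cons (encodeVertex w) (encodeList (map encodeVertex S))))
               ≡ encodeList (map encodeVertex (greedy k Rs (w ∷ us)))
      step rewrite program-correct (structure S k Rs) φ (w ∷ [])
        with sat φ (structure S k Rs) (w ∷ [])
      ... | true  = refl
      ... | false = refl

-- The kernel

-- Each relation defined is put in front of the earlier ones; in the end they
-- are, in this order: near a paw, clean pair, twin, connected, adjacent.
twinᶠ : Formula 2 2
twinᶠ = ¬ᶠ ∃ᶠ ((rel 1F 2F 0F ∧ᶠ ¬ᶠ rel 1F 1F 0F) ∨ᶠ (¬ᶠ rel 1F 2F 0F ∧ᶠ rel 1F 1F 0F))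

-- In its component, u is clean when its part of the complement is a clique:
-- the vertices not adjacent to u are all twins of u.
cleanᶠ : ∀ {j} → Fin j → Formula 3 j
cleanᶠ i = ¬ᶠ ∃ᶠ (rel 1F (suc i) 0F ∧ᶠ ¬ᶠ rel 2F (suc i) 0F ∧ᶠ ¬ᶠ rel 0F (suc i) 0F)

cleanPairᶠ : Formula 3 2
cleanPairᶠ = cleanᶠ 1F ∧ᶠ cleanᶠ 0F ∧ᶠ rel 1F 1F 0F

-- A unary relation, given as a binary relation that ignores its second argument.
nearPawᶠ : Formula 4 2
nearPawᶠ = ∃ᶠ ∃ᶠ ∃ᶠ ∃ᶠ (rel 3F 0F 1F ∧ᶠ rel 3F 1F 2F ∧ᶠ rel 3F 0F 2F ∧ᶠ rel 3F 2F 3F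
  ∧ᶠ ¬ᶠ rel 3F 0F 3F ∧ᶠ ¬ᶠ rel 3F 1F 3F ∧ᶠ rel 2F 5F 0F)

-- Since the quantifiers range over the vertices kept so far, the threshold `2k` lets a class of
-- twins grow to `2k + 1`, and the second conjunct admits one clean vertex per component.
keepᶠ : Formula 5 1
keepᶠ = rel 0F 0F 0F ∧ᶠ (¬ᶠ ∃ᶠ (rel 1F 1F 0F)) ∧ᶠ fewᶠ (rel 2F 1F 0F)

module _ {n : ℕ} (G : Graph n) (k : ℕ) where

  structure₂ : Structure n 2
  structure₂ = structure (allVertices n) k (warshall (allVertices n) (adj G) ∷ adj G ∷ [])

  structure₅ : Structure n 5
  structure₅ = expand nearPawᶠ (expand cleanPairᶠ (expand twinᶠ structure₂))

  kept : List (Fin n)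
  kept = greedy keepᶠ k (relations structure₅) (allFin n)

induced : ∀ {m n} → Graph n → (Fin m → Fin n) → Graph m
induced G f = record
  { adj    = λ i j → adj G (f i) (f j)
  ; sym    = λ i j → Graph.sym G (f i) (f j)
  ; irrefl = λ i → irrefl G (f i)
  }

-- This is `2k (2k + 3)`, arranged as `k` rounds of dropping `k` four times and then 6, the way
-- `limitFun` compares it with a list.
limit : ℕ → ℕ
limit k = k * (k + (k + (k + (k + 6))))

-- The outcome of the size test is an argument so that correctness can be shown by cases on it. The
-- fixed instance `⟨ paw , 0 ⟩` is a no-instance, and `reverse` matches the order in which `collect`
-- emits rows.
decided : Instance → Bool → Instance
decided ⟨ G , k ⟩ true  = ⟨ induced G (List.lookup (reverse (kept G k))) , k ⟩
decided ⟨ G , k ⟩ false = ⟨ paw , 0 ⟩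

kernel : Instance → Instance
kernel ⟨ G , k ⟩ = decided ⟨ G , k ⟩ (length (kept G k) ≤ᵇ limit k)

-- The program that computes the kernel

verticesBody verticesFun baseFun : Fun
verticesBody = pure (cons (cons nil (hd state)) state)
verticesFun  = pure (tl x₀) ⊙ fold verticesBody ⊙ pure (cons nil (cons (hd x₀) (cons nil nil)))
baseFun = both verticesFun (pure (cons (tl x₀) (cons (hd x₀) nil)))

-- A step copies the head of the state, so its growth depends on the state and `additive` does not
-- apply. The potential charges each remaining step with the head that it will copy, which itself
-- grows by 2 per step.
verticesPotential : Potential verticesBody
verticesPotential = record
  { β       = λ c xs s → size s + size xs * (size (left s) + (2 + size xs))
  ; size≤β  = λ c xs s → m≤m+n _ _
  ; descend = λ c y ys s → descend (size y) (size ys) (size s) (size (left s))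
  ; bound   = X ⊞ X ⊠ (X ⊞ (con 2 ⊞ X))
  ; β≤      = λ {c} {xs} {s} c≤ xs≤ s≤ → +-mono-≤ s≤
      (*-mono-≤ xs≤ (+-mono-≤ (≤-trans (size-left s) s≤) (+-monoʳ-≤ 2 xs≤)))
  }
  where
  open ≤-Reasoning
  descend : ∀ y m s h → 1 + (2 + h) + s + m * (2 + h + (2 + m)) ≤ s + (1 + y + m) * (h + (2 + (1 + y + m)))
  descend y m s h = begin
    1 + (2 + h) + s + m * (2 + h + (2 + m)) ≡⟨ rearrange m s h ⟩
    s + (1 + m) * (h + (2 + (1 + m)))       ≤⟨ +-monoʳ-≤ s (*-mono-≤ m≤ (+-monoʳ-≤ h (+-monoʳ-≤ 2 m≤))) ⟩
    s + (1 + y + m) * (h + (2 + (1 + y + m))) ∎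
    where
    m≤ : 1 + m ≤ 1 + y + m
    m≤ = s≤s (m≤n+m m y)
    rearrange : ∀ m s h → 1 + (2 + h) + s + m * (2 + h + (2 + m)) ≡ s + (1 + m) * (h + (2 + (1 + m)))
    rearrange = solve-∀

feasible-base : Feasible baseFun
feasible-base = feasible-both
  (feasible-⊙ (feasible-pure _)
    (feasible-⊙ (feasible-fold (feasible-pure _) verticesPotential) (feasible-pure _)))
  (feasible-pure _)

map-toℕ-allVertices : ∀ n → map toℕ (allVertices n) ≡ downFrom n
map-toℕ-allVertices n = begin
  map toℕ (reverse (allFin n)) ≡⟨ reverse-map toℕ (allFin n) ⟩
  reverse (map toℕ (allFin n)) ≡⟨ cong reverse (trans (map-tabulate id toℕ) (tabulate-toℕ id n)) ⟩
  reverse (upTo n)             ≡⟨ reverse-upTo n ⟩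
  downFrom n                   ∎
  where
  open ≡-Reasoning
  tabulate-toℕ : ∀ (f : ℕ → ℕ) n → tabulate {n = n} (f ∘ toℕ) ≡ applyUpTo f n
  tabulate-toℕ f zero    = refl
  tabulate-toℕ f (suc n) = cong (f 0 ∷_) (tabulate-toℕ (f ∘ suc) n)

-- The fold starts from the list with the single entry 0 and adds one number per row, ending in
-- `n , ... , 0`; the final `tl` removes the surplus `n`.
vertices-correct : ∀ {n} (rows : Fin n → Tree) k →
  ⟦ verticesFun ⟧ (cons (encodeList (tabulate rows)) k) ≡ encodeList (map encodeVertex (allVertices n))
vertices-correct {n} rows k = begin
  right (folded verticesBody nil (encodeList (tabulate rows)) (encodeList (map encodeℕ (downFrom 1))))
    ≡⟨ cong right (go 0 (tabulate rows)) ⟩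
  encodeList (map encodeℕ (downFrom (length (tabulate rows) + 0)))
    ≡⟨ cong (λ l → encodeList (map encodeℕ (downFrom l))) (trans (+-identityʳ _) (length-tabulate rows)) ⟩
  encodeList (map encodeℕ (downFrom n))
    ≡⟨ cong (λ us → encodeList (map encodeℕ us)) (map-toℕ-allVertices n) ⟨
  encodeList (map encodeℕ (map toℕ (allVertices n)))
    ≡⟨ cong encodeList (map-∘ (allVertices n)) ⟨
  encodeList (map encodeVertex (allVertices n)) ∎
  where
  open ≡-Reasoning
  go : ∀ a ts → folded verticesBody nil (encodeList ts) (encodeList (map encodeℕ (downFrom (1 + a))))
                  ≡ encodeList (map encodeℕ (downFrom (1 + (length ts + a))))
  go a []       = refl
  go a (t ∷ ts) = trans (go (suc a) ts)
    (cong (λ l → encodeList (map encodeℕ (downFrom (1 + l)))) (+-suc (length ts) a))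

limitBody limitFun : Fun
limitBody = pure (tls 6 x₀)
  ⊙ dropFun ⊙ both (pure context)
    (dropFun ⊙ both (pure context)
      (dropFun ⊙ both (pure context)
        (dropFun ⊙ both (pure context) (pure state))))
limitFun = fold limitBody ⊙ pure (cons (hd (tl x₀)) (cons (hd (tl x₀)) (hd x₀)))

size-drops : ∀ i t → size (drops i t) ≤ size t
size-drops zero    t = ≤-refl
size-drops (suc i) t = ≤-trans (size-drops i (right t)) (size-right t)

feasible-limit : Feasible limitFun
feasible-limit = feasible-⊙
  (feasible-fold
    (feasible-⊙ (feasible-pure _) (dropping (dropping (dropping (dropping (feasible-pure _))))))
    (additive (con 0) λ c y s →
      let t₁ = ⟦ dropFun ⟧ (cons c s)
          t₂ = ⟦ dropFun ⟧ (cons c t₁)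
          t₃ = ⟦ dropFun ⟧ (cons c t₂)
      in ≤-trans (size-drops 6 (⟦ dropFun ⟧ (cons c t₃)))
      (≤-trans (size-drop c t₃) (≤-trans (size-drop c t₂) (≤-trans (size-drop c t₁)
        (≤-trans (size-drop c s) (m≤m+n (size s) 0)))))))
  (feasible-pure _)
  where
  dropping : ∀ {f} → Feasible f → Feasible (dropFun ⊙ both (pure context) f)
  dropping F = feasible-⊙ feasible-drop (feasible-both (feasible-pure _) F)

limit-correct : ∀ k t r → ⟦ limitFun ⟧ (cons t (cons (encodeℕ k) r)) ≡ drops (limit k) t
limit-correct k t r = go k t
  where
  per = k + (k + (k + (k + 6)))
  step : ∀ y s → ⟦ limitBody ⟧ (cons (encodeℕ k) (cons y s)) ≡ drops per s
  step y s
    rewrite drop-correct k s | drop-correct k (drops k s)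
          | drop-correct k (drops k (drops k s)) | drop-correct k (drops k (drops k (drops k s)))
          | drops-+ k (k + (k + (k + 6))) s | drops-+ k (k + (k + 6)) (drops k s)
          | drops-+ k (k + 6) (drops k (drops k s)) | drops-+ k 6 (drops k (drops k (drops k s))) = refl
  go : ∀ i s → folded limitBody (encodeℕ k) (encodeℕ i) s ≡ drops (i * per) s
  go zero    s = refl
  go (suc i) s rewrite step nil s | drops-+ per (i * per) s = go i (drops per s)

constant : Tree → Expr 1
constant nil        = nil
constant (cons s t) = cons (constant s) (constant t)

constant-correct : ∀ t s → eval (constant t) s ≡ t
constant-correct nil         s = refl
constant-correct (cons t t′) s = cong₂ cons (constant-correct t s) (constant-correct t′ s)

closeFun selectFun outputFun kernelFun : Fun
closeFun  = both (pure (hd x₀)) (both (pure (hd (tl x₀))) (both warshallFun (pure (tl (tl x₀)))))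
selectFun = both (greedyFun keepᶠ) (pure (tl x₀))
outputFun = cond limitFun (pure (constant (encodeInstance ⟨ paw , 0 ⟩)))
              (both (define 0 (rel {m = 5} 4F 1F 0F)) (pure (hd (tl x₀))))
kernelFun = outputFun ⊙ selectFun ⊙ expandFun nearPawᶠ ⊙ expandFun cleanPairᶠ ⊙ expandFun twinᶠ
              ⊙ closeFun ⊙ baseFun

feasible-kernel : Feasible kernelFun
feasible-kernel =
  feasible-⊙ (feasible-cond feasible-limit (feasible-pure _)
               (feasible-both (feasible-define 0 (rel {m = 5} 4F 1F 0F)) (feasible-pure _)))
  (feasible-⊙ (feasible-both (feasible-greedy keepᶠ) (feasible-pure _))
  (feasible-⊙ (feasible-expand nearPawᶠ) (feasible-⊙ (feasible-expand cleanPairᶠ)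
  (feasible-⊙ (feasible-expand twinᶠ)
  (feasible-⊙ (feasible-both (feasible-pure _) (feasible-both (feasible-pure _)
                (feasible-both feasible-warshall (feasible-pure _))))
              feasible-base)))))

encodeGraph-induced : ∀ {n} (G : Graph n) vs →
  encodeGraph (induced G (List.lookup vs))
    ≡ encodeList (map (λ u → encodeList (map (λ v → encodeBool (adj G u v)) vs)) vs)
encodeGraph-induced G vs = begin
  encodeList (tabulate λ i → encodeList (tabulate λ j → cell (List.lookup vs i) (List.lookup vs j)))
    ≡⟨ cong encodeList (tabulate-cong λ i → cong encodeList (tabulated (cell (List.lookup vs i)))) ⟩
  encodeList (tabulate λ i → encodeList (map (cell (List.lookup vs i)) vs))
    ≡⟨ cong encodeList (tabulated (λ u → encodeList (map (cell u) vs))) ⟩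
  encodeList (map (λ u → encodeList (map (cell u) vs)) vs) ∎
  where
  open ≡-Reasoning
  cell : _ → _ → Tree
  cell u v = encodeBool (adj G u v)
  tabulated : ∀ (f : _ → Tree) → tabulate (f ∘ List.lookup vs) ≡ map f vs
  tabulated f = trans (≡-sym (map-tabulate (List.lookup vs) f)) (cong (map f) (tabulate-lookup vs))

output-correct : ∀ {n} (G : Graph n) k →
  ⟦ outputFun ⟧ (encodeStructure (structure (kept G k) k (relations (structure₅ G k))))
    ≡ encodeInstance (kernel ⟨ G , k ⟩)
output-correct {n} G k = begin
  branch (⟦ limitFun ⟧ e) reject accept e
    ≡⟨ cong (λ t → branch t reject accept e) (limit-correct k (encodeList (map encodeVertex S)) (encodeRels (relations A))) ⟩
  branch (drops (limit k) (encodeList (map encodeVertex S))) reject accept e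
    ≡⟨ longer S (limit k) ⟩
  branch (encodeBool (length S ≤ᵇ limit k)) accept reject e
    ≡⟨ finish (length S ≤ᵇ limit k) ⟩
  encodeInstance (kernel ⟨ G , k ⟩) ∎
  where
  open ≡-Reasoning
  S = kept G k
  A = structure S k (relations (structure₅ G k))
  e = encodeStructure A
  reject  = pure (constant (encodeInstance ⟨ paw , 0 ⟩))
  accept = both (define 0 (rel {m = 5} 4F 1F 0F)) (pure (hd (tl x₀)))

  longer : ∀ us d → branch (drops d (encodeList (map encodeVertex us))) reject accept e
                      ≡ branch (encodeBool (length us ≤ᵇ d)) accept reject e
  longer []           zero    = refl
  longer []           (suc d) = longer [] d
  longer (u ∷ us)     zero    = refl
  longer (u ∷ [])     (suc d) = longer [] d
  longer (u ∷ v ∷ us) (suc d) = longer (v ∷ us) d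

  finish : ∀ b → branch (encodeBool b) accept reject e ≡ encodeInstance (decided ⟨ G , k ⟩ b)
  finish false = constant-correct (encodeInstance ⟨ paw , 0 ⟩) (e ∷ [])
  finish true  = cong (λ t → cons t (encodeℕ k))
    (trans (define-correct A (rel 4F 1F 0F) []) (≡-sym (encodeGraph-induced G (reverse S))))

base-correct : ∀ {n} (G : Graph n) k →
  ⟦ baseFun ⟧ (encodeInstance ⟨ G , k ⟩) ≡ encodeStructure (structure (allVertices n) k (adj G ∷ []))
base-correct G k = cong (λ t → cons t (cons (encodeℕ k) (cons (encodeGraph G) nil)))
  (vertices-correct (λ u → encodeList (tabulate λ v → encodeBool (adj G u v))) (encodeℕ k))

close-correct : ∀ {n} (G : Graph n) k →
  ⟦ closeFun ⟧ (encodeStructure (structure (allVertices n) k (adj G ∷ []))) ≡ encodeStructure (structure₂ G k)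
close-correct {n} G k =
  cong (λ R → cons (encodeList (map encodeVertex (allVertices n))) (cons (encodeℕ k) (cons R (cons (encodeGraph G) nil))))
    (warshall-correct k (adj G))

select-correct : ∀ {n} (G : Graph n) k →
  ⟦ selectFun ⟧ (encodeStructure (structure₅ G k))
    ≡ encodeStructure (structure (kept G k) k (relations (structure₅ G k)))
select-correct G k = cong (λ t → cons t (cons (encodeℕ k) (encodeRels (relations (structure₅ G k)))))
  (greedy-correct keepᶠ k (relations (structure₅ G k)))

⟦⟧-compose : ∀ x f g {y z} → ⟦ f ⟧ y ≡ z → ⟦ g ⟧ x ≡ y → ⟦ f ⊙ g ⟧ x ≡ z
⟦⟧-compose x f g f≡ g≡ = trans (cong ⟦ f ⟧ g≡) f≡

kernel-correct : ∀ I → ⟦ kernelFun ⟧ (encodeInstance I) ≡ encodeInstance (kernel I)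
kernel-correct ⟨ G , k ⟩ =
  ⟦⟧-compose x outputFun f₅ (output-correct G k) (
  ⟦⟧-compose x selectFun f₄ (select-correct G k) (
  ⟦⟧-compose x (expandFun nearPawᶠ) f₃ (expand-correct k (relations A₄) nearPawᶠ) (
  ⟦⟧-compose x (expandFun cleanPairᶠ) f₂ (expand-correct k (relations A₃) cleanPairᶠ) (
  ⟦⟧-compose x (expandFun twinᶠ) f₁ (expand-correct k (relations A₂) twinᶠ) (
  ⟦⟧-compose x closeFun baseFun (close-correct G k) (base-correct G k))))))
  where
  x  = encodeInstance ⟨ G , k ⟩
  f₁ = closeFun ⊙ baseFun
  f₂ = expandFun twinᶠ ⊙ f₁
  f₃ = expandFun cleanPairᶠ ⊙ f₂
  f₄ = expandFun nearPawᶠ ⊙ f₃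
  f₅ = selectFun ⊙ f₄
  A₂ = structure₂ G k
  A₃ = expand twinᶠ A₂
  A₄ = expand cleanPairᶠ A₃

kernel-polynomialTime : PolynomialTime encodeInstance encodeInstance kernel
kernel-polynomialTime = feasible⇒polynomialTime encodeInstance encodeInstance {f = kernel} feasible-kernel kernel-correct

-- Booleans and counting

clash : ∀ {A : Set} {b} → b ≡ true → b ≡ false → A
clash refl ()

true⊎false : ∀ b → b ≡ true ⊎ b ≡ false
true⊎false true  = inj₁ refl
true⊎false false = inj₂ refl

≡-from-⇔ : ∀ {a b} → (a ≡ true → b ≡ true) → (b ≡ true → a ≡ true) → a ≡ b
≡-from-⇔ {true}         f g = ≡-sym (f refl)
≡-from-⇔ {false} {true} f g = g refl
≡-from-⇔ {false} {false} f g = refl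

∧-true⁻ : ∀ {a b} → a ∧ b ≡ true → a ≡ true × b ≡ true
∧-true⁻ {true} {true} _ = refl , refl

∧-true⁺ : ∀ {a b} → a ≡ true → b ≡ true → a ∧ b ≡ true
∧-true⁺ refl refl = refl

∨-true⁻ : ∀ {a b} → a ∨ b ≡ true → a ≡ true ⊎ b ≡ true
∨-true⁻ {true}  _ = inj₁ refl
∨-true⁻ {false} p = inj₂ p

∨-true⁺ˡ : ∀ {a b} → a ≡ true → a ∨ b ≡ true
∨-true⁺ˡ refl = refl

∨-true⁺ʳ : ∀ {a b} → b ≡ true → a ∨ b ≡ true
∨-true⁺ʳ {true}  _    = refl
∨-true⁺ʳ {false} refl = refl

not-true⁻ : ∀ {a} → not a ≡ true → a ≡ false
not-true⁻ {false} _ = refl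

not-true⁺ : ∀ {a} → a ≡ false → not a ≡ true
not-true⁺ refl = refl

not-false⁻ : ∀ {a} → not a ≡ false → a ≡ true
not-false⁻ {true} _ = refl

does-true⁻ : ∀ {P : Set} (d : Dec P) → does d ≡ true → P
does-true⁻ (yes p) _ = p

does-true⁺ : ∀ {P : Set} (d : Dec P) → P → does d ≡ true
does-true⁺ (yes _) p = refl
does-true⁺ (no ¬p) p = ⊥-elim (¬p p)

module _ {A : Set} {p : A → Bool} where

  any-true⁻ : ∀ xs → any p xs ≡ true → ∃[ x ] x ∈ xs × p x ≡ true
  any-true⁻ (x ∷ xs) h with ∨-true⁻ {p x} h
  ... | inj₁ px = x , here refl , px
  ... | inj₂ h′ with any-true⁻ xs h′
  ...   | y , y∈ , py = y , there y∈ , py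

  any-true⁺ : ∀ {x xs} → x ∈ xs → p x ≡ true → any p xs ≡ true
  any-true⁺ (here refl) px = ∨-true⁺ˡ px
  any-true⁺ {xs = y ∷ xs} (there x∈) px = ∨-true⁺ʳ {p y} (any-true⁺ x∈ px)

  any-false⁻ : ∀ {x xs} → any p xs ≡ false → x ∈ xs → p x ≡ false
  any-false⁻ {x} none x∈ with true⊎false (p x)
  ... | inj₁ px = clash (any-true⁺ x∈ px) none
  ... | inj₂ px = px

  count>0 : ∀ xs → 0 < count p xs → ∃[ x ] x ∈ xs × p x ≡ true
  count>0 (x ∷ xs) h with p x in px
  ... | true  = x , here refl , px
  ... | false with count>0 xs h
  ...   | y , y∈ , py = y , there y∈ , py

module _ {A : Set} where

  count-const-true : ∀ (xs : List A) → count (λ _ → true) xs ≡ length xs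
  count-const-true []       = refl
  count-const-true (x ∷ xs) = cong suc (count-const-true xs)

  count-∷ : ∀ p (x : A) xs → count p xs ≤ count p (x ∷ xs)
  count-∷ p x xs with p x
  ... | true  = n≤1+n _
  ... | false = ≤-refl

  count-mono : ∀ {p q : A → Bool} xs → (∀ {x} → x ∈ xs → p x ≡ true → q x ≡ true) →
    count p xs ≤ count q xs
  count-mono []       h = z≤n
  count-mono {p} {q} (x ∷ xs) h with p x in px | q x in qx
  ... | true  | true  = s≤s (count-mono xs (h ∘ there))
  ... | true  | false = clash (h (here refl) px) qx
  ... | false | true  = m≤n⇒m≤1+n (count-mono xs (h ∘ there))
  ... | false | false = count-mono xs (h ∘ there)

  count-cong : ∀ {p q : A → Bool} xs → (∀ x → p x ≡ q x) → count p xs ≡ count q xs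
  count-cong xs h = ≤-antisym (count-mono xs (λ {x} _ → trans (≡-sym (h x))))
                              (count-mono xs (λ {x} _ → trans (h x)))

  count-cover : ∀ {p q r : A → Bool} xs →
    (∀ {x} → x ∈ xs → p x ≡ true → q x ≡ true ⊎ r x ≡ true) →
    count p xs ≤ count q xs + count r xs
  count-cover []       h = z≤n
  count-cover {p} {q} {r} (x ∷ xs) h with p x in px | q x in qx | r x in rx | count-cover {p} {q} {r} xs (h ∘ there)
  ... | true  | true  | true  | ih = s≤s (≤-trans ih (+-monoʳ-≤ _ (n≤1+n _)))
  ... | true  | true  | false | ih = s≤s ih
  ... | true  | false | true  | ih = ≤-trans (s≤s ih) (≤-reflexive (≡-sym (+-suc _ _)))
  ... | true  | false | false | ih = [ (λ e → clash e qx) , (λ e → clash e rx) ]′ (h (here refl) px)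
  ... | false | true  | true  | ih = m≤n⇒m≤1+n (≤-trans ih (+-monoʳ-≤ _ (n≤1+n _)))
  ... | false | true  | false | ih = m≤n⇒m≤1+n ih
  ... | false | false | true  | ih = ≤-trans ih (+-monoʳ-≤ _ (n≤1+n _))
  ... | false | false | false | ih = ih

  count-≤1 : ∀ {p : A → Bool} {xs} → Unique xs →
    (∀ {x y} → x ∈ xs → y ∈ xs → p x ≡ true → p y ≡ true → x ≡ y) → count p xs ≤ 1
  count-≤1 {xs = []}     []        h = z≤n
  count-≤1 {p} {x ∷ xs} (x∉ ∷ uniq) h with p x in px | count-≤1 {p} uniq (λ y∈ z∈ → h (there y∈) (there z∈))
  ... | false | ih = ih
  ... | true  | _ with count p xs in eq
  ...   | zero  = ≤-refl
  ...   | suc c with count>0 {p = p} xs (subst (0 <_) (≡-sym eq) (s≤s z≤n))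
  ...     | y , y∈ , py = ⊥-elim (All.lookup x∉ y∈ (h (here refl) (there y∈) px py))

  -- A charging argument by induction on `es`: what `p e` covers is split off, and `rest` is still
  -- covered by the remaining elements.
  cover-bound : ∀ {B : Set} {b} (p : B → A → Bool) (es : List B) xs (q : A → Bool) →
    (∀ {e} → e ∈ es → count (p e) xs ≤ b) →
    (∀ {x} → x ∈ xs → q x ≡ true → ∃[ e ] e ∈ es × p e x ≡ true) →
    count q xs ≤ length es * b
  cover-bound p [] xs q few covered with count q xs in eq
  ... | zero  = z≤n
  ... | suc c with count>0 {p = q} xs (subst (0 <_) (≡-sym eq) (s≤s z≤n))
  ...   | x , x∈ , qx with covered x∈ qx
  ...     | _ , () , _
  cover-bound {b = b} p (e ∷ es) xs q few covered = ≤-trans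
    (count-cover {q = p e} {r = rest} xs split)
    (+-mono-≤ (few (here refl)) (cover-bound p es xs rest (few ∘ there) covered′))
    where
    rest : A → Bool
    rest x = q x ∧ not (p e x)
    split : ∀ {x} → x ∈ xs → q x ≡ true → p e x ≡ true ⊎ rest x ≡ true
    split {x} _ qx with true⊎false (p e x)
    ... | inj₁ t = inj₁ t
    ... | inj₂ f = inj₂ (∧-true⁺ qx (not-true⁺ f))
    covered′ : ∀ {x} → x ∈ xs → rest x ≡ true → ∃[ e′ ] e′ ∈ es × p e′ x ≡ true
    covered′ x∈ h with ∧-true⁻ h
    ... | qx , ¬pe with covered x∈ qx
    ...   | _  , here refl , pe = clash pe (not-true⁻ ¬pe)
    ...   | e′ , there e′∈ , pe = e′ , e′∈ , pe

_∈?_ : ∀ {n} (v : Fin n) vs → Dec (v ∈ vs)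
_∈?_ = DecMembership._∈?_ _≟_

-- Otherwise the singletons of the members of `es` would cover `q`.
pigeonhole : ∀ {n} {vs : List (Fin n)} {q} es → Unique vs → length es < count q vs →
  ∃[ v ] v ∈ vs × q v ≡ true × v ∉ es
pigeonhole {vs = vs} {q} es uniq big with true⊎false (any (λ v → q v ∧ not (does (v ∈? es))) vs)
... | inj₁ found with any-true⁻ vs found
...   | v , v∈ , h with ∧-true⁻ h
...     | qv , v∉ = v , v∈ , qv , λ v∈es → clash (does-true⁺ (v ∈? es) v∈es) (not-true⁻ v∉)
pigeonhole {vs = vs} {q} es uniq big | inj₂ none = ⊥-elim (<-irrefl refl (<-≤-trans big
  (≤-trans (cover-bound (λ e v → does (v ≟ e)) es vs q
      (λ {e} _ → count-≤1 uniq λ {x} {y} _ _ hx hy → trans (does-true⁻ (x ≟ e) hx) (≡-sym (does-true⁻ (y ≟ e) hy)))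
      covered)
    (≤-reflexive (*-identityʳ (length es))))))
  where
  covered : ∀ {v} → v ∈ vs → q v ≡ true → ∃[ e ] e ∈ es × does (v ≟ e) ≡ true
  covered {v} v∈ qv with v ∈? es in eq
  ... | yes v∈es = v , v∈es , does-true⁺ (v ≟ v) refl
  ... | no  v∉es = clash (∧-true⁺ qv (not-true⁺ (cong does eq))) (any-false⁻ none v∈)

-- Paws

module _ {n : ℕ} (G : Graph n) where

  Adj Non : Fin n → Fin n → Set
  Adj u v = adj G u v ≡ true
  Non u v = adj G u v ≡ false

  Adj-sym : ∀ {u v} → Adj u v → Adj v u
  Adj-sym {u} {v} = trans (Graph.sym G v u)

  Non-sym : ∀ {u v} → Non u v → Non v u
  Non-sym {u} {v} = trans (Graph.sym G v u)

  record IsPaw (a b c d : Fin n) : Set where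
    constructor isPaw
    field
      ab : Adj a b
      bc : Adj b c
      ac : Adj a c
      cd : Adj c d
      ad : Non a d
      bd : Non b d

-- The paw has no twins, so a map that preserves its adjacency is injective for free, and `IsPaw`
-- can do without distinctness conditions.
paw-rows : ∀ i j → (∀ l → adj paw i l ≡ adj paw j l) → i ≡ j
paw-rows x₁ x₁ h = refl
paw-rows x₁ x₂ h = case h x₁ of λ ()
paw-rows x₁ x₃ h = case h x₁ of λ ()
paw-rows x₁ x₄ h = case h x₂ of λ ()
paw-rows x₂ x₁ h = case h x₁ of λ ()
paw-rows x₂ x₂ h = refl
paw-rows x₂ x₃ h = case h x₂ of λ ()
paw-rows x₂ x₄ h = case h x₁ of λ ()
paw-rows x₃ x₁ h = case h x₁ of λ ()
paw-rows x₃ x₂ h = case h x₂ of λ ()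
paw-rows x₃ x₃ h = refl
paw-rows x₃ x₄ h = case h x₁ of λ ()
paw-rows x₄ x₁ h = case h x₂ of λ ()
paw-rows x₄ x₂ h = case h x₁ of λ ()
paw-rows x₄ x₃ h = case h x₁ of λ ()
paw-rows x₄ x₄ h = refl

module _ {n : ℕ} {G : Graph n} where

  paw⇒copy : ∀ {a b c d} → IsPaw G a b c d → InducedCopy paw G
  paw⇒copy {a} {b} {c} {d} (isPaw ab bc ac cd ad bd) = record
    { vertex    = f
    ; injective = λ {i} {j} eq → paw-rows i j λ l →
        trans (≡-sym (preserved i l)) (trans (cong (λ v → adj G v (f l)) eq) (preserved j l))
    ; preserves = preserved
    }
    where
    f : Fin 4 → Fin n
    f x₁ = a
    f x₂ = b
    f x₃ = c
    f x₄ = d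
    preserved : ∀ i j → adj G (f i) (f j) ≡ adj paw i j
    preserved x₁ x₁ = irrefl G a
    preserved x₁ x₂ = ab
    preserved x₁ x₃ = ac
    preserved x₁ x₄ = ad
    preserved x₂ x₁ = Adj-sym G ab
    preserved x₂ x₂ = irrefl G b
    preserved x₂ x₃ = bc
    preserved x₂ x₄ = bd
    preserved x₃ x₁ = Adj-sym G ac
    preserved x₃ x₂ = Adj-sym G bc
    preserved x₃ x₃ = irrefl G c
    preserved x₃ x₄ = cd
    preserved x₄ x₁ = Non-sym G ad
    preserved x₄ x₂ = Non-sym G bd
    preserved x₄ x₃ = Adj-sym G cd
    preserved x₄ x₄ = irrefl G d

  copy⇒paw : (I : InducedCopy paw G) → let f = InducedCopy.vertex I in IsPaw G (f x₁) (f x₂) (f x₃) (f x₄)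
  copy⇒paw I = isPaw (p x₁ x₂) (p x₂ x₃) (p x₁ x₃) (p x₃ x₄) (p x₁ x₄) (p x₂ x₄)
    where p = InducedCopy.preserves I

-- A connected paw-free graph with a triangle is complete multipartite

module Multipartite {n : ℕ} (H : Graph n) (free : PawFree H) (C : Fin n → Set)
  -- Connectivity of `C` as an induction principle: it avoids paths and can be supplied from
  -- connectivity in another graph.
  (connected : ∀ (P : Fin n → Set) → (∀ {u v} → Adj H u v → P u → P v) → ∀ {u v} → C u → C v → P u → P v)
  where

  Triangle : Fin n → Fin n → Fin n → Set
  Triangle x y z = Adj H x y × Adj H y z × Adj H x z

  attach : ∀ {x y z v} → Triangle x y z → Adj H z v → Adj H x v ⊎ Adj H y v
  attach {x} {y} {z} {v} (xy , yz , xz) zv with true⊎false (adj H x v) | true⊎false (adj H y v)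
  ... | inj₁ xv | _       = inj₁ xv
  ... | inj₂ _  | inj₁ yv = inj₂ yv
  ... | inj₂ xv | inj₂ yv = ⊥-elim (free (paw⇒copy (isPaw xy yz xz zv xv yv)))

  -- Two neighbours in the triangle rather than one make the invariant inductive: with two of them
  -- `u` forms a new triangle, to which `attach` applies for the next edge.
  Dominated : Fin n → Fin n → Fin n → Fin n → Set
  Dominated x y z v = (Adj H x v × Adj H y v) ⊎ (Adj H y v × Adj H z v) ⊎ (Adj H x v × Adj H z v)

  dominated : ∀ {x y z v} → Triangle x y z → C x → C v → Dominated x y z v
  dominated {x} {y} {z} t@(xy , yz , xz) cx cv =
    connected (Dominated x y z) closed cx cv (inj₂ (inj₁ (Adj-sym H xy , Adj-sym H xz)))
    where
    yx = Adj-sym H xy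
    zy = Adj-sym H yz
    zx = Adj-sym H xz
    hit-x : ∀ {v} → Adj H x v → Dominated x y z v
    hit-x xv with attach (yz , zx , yx) xv
    ... | inj₁ yv = inj₁ (xv , yv)
    ... | inj₂ zv = inj₂ (inj₂ (xv , zv))
    hit-y : ∀ {v} → Adj H y v → Dominated x y z v
    hit-y yv with attach (xz , zy , xy) yv
    ... | inj₁ xv = inj₁ (xv , yv)
    ... | inj₂ zv = inj₂ (inj₁ (yv , zv))
    hit-z : ∀ {v} → Adj H z v → Dominated x y z v
    hit-z zv with attach t zv
    ... | inj₁ xv = inj₂ (inj₂ (xv , zv))
    ... | inj₂ yv = inj₂ (inj₁ (yv , zv))
    closed : ∀ {u v} → Adj H u v → Dominated x y z u → Dominated x y z v
    closed uv (inj₁ (xu , yu))        = [ hit-x , hit-y ]′ (attach (xy , yu , xu) uv)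
    closed uv (inj₂ (inj₁ (yu , zu))) = [ hit-y , hit-z ]′ (attach (yz , zu , yu) uv)
    closed uv (inj₂ (inj₂ (xu , zu))) = [ hit-x , hit-z ]′ (attach (xz , zu , xu) uv)

  module _ {x y z} (t : Triangle x y z) (cx : C x) where

    -- Two neighbours of `p` in the given triangle form a triangle `p s t` with it; `q` is adjacent
    -- to two of its vertices, hence to `s` or `t`.
    edge-in-triangle : ∀ {p q} → C p → C q → Adj H p q → ∃[ w ] Triangle p q w
    edge-in-triangle {p} {q} cp cq pq = third-vertex (vertex-in-triangle (dominated t cx cp))
      where
      vertex-in-triangle : Dominated x y z p → ∃[ s ] ∃[ t ] Triangle p s t
      vertex-in-triangle (inj₁ (xp , yp))        = x , y , Adj-sym H xp , proj₁ t , Adj-sym H yp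
      vertex-in-triangle (inj₂ (inj₁ (yp , zp))) = y , z , Adj-sym H yp , proj₁ (proj₂ t) , Adj-sym H zp
      vertex-in-triangle (inj₂ (inj₂ (xp , zp))) = x , z , Adj-sym H xp , proj₂ (proj₂ t) , Adj-sym H zp
      third-vertex : ∃[ s ] ∃[ t ] Triangle p s t → ∃[ w ] Triangle p q w
      third-vertex (s , t , pst@(ps , st , pt)) with dominated pst cp cq
      ... | inj₁ (_ , sq)        = s , pq , Adj-sym H sq , ps
      ... | inj₂ (inj₁ (sq , _)) = s , pq , Adj-sym H sq , ps
      ... | inj₂ (inj₂ (_ , tq)) = t , pq , Adj-sym H tq , pt

    -- With a common neighbour `w` of `p` and `q`, the vertex `r` is adjacent to two of `p`, `q`,
    -- `w`, hence to `p` or `q`.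
    multipartite : ∀ {p q r} → C p → C q → C r → Adj H p q → Non H p r → Non H q r → ⊥
    multipartite cp cq cr pq pr qr with edge-in-triangle cp cq pq
    ... | w , pqw with dominated pqw cp cr
    ...   | inj₁ (pr′ , _)        = clash pr′ pr
    ...   | inj₂ (inj₁ (qr′ , _)) = clash qr′ qr
    ...   | inj₂ (inj₂ (pr′ , _)) = clash pr′ pr

-- Edge additions given by arbitrary lists of ordered pairs

Joined : ∀ {n} → List (Fin n × Fin n) → Fin n → Fin n → Set
Joined L u v = (u , v) ∈ L ⊎ (v , u) ∈ L

-- Loops in L and pairs that are adjacent in G already have no effect.
record Completes {n} (G : Graph n) (L : List (Fin n × Fin n)) (H : Graph n) : Set where
  field
    adj⁻ : ∀ {u v} → Adj H u v → Adj G u v ⊎ Joined L u v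
    adj⁺ : ∀ {u v} → u ≢ v → Adj G u v ⊎ Joined L u v → Adj H u v

  old : ∀ {u v} → Adj G u v → Adj H u v
  old {u} uv = adj⁺ (λ { refl → clash uv (irrefl G u) }) (inj₁ uv)

  old-non : ∀ {u v} → Non H u v → Non G u v
  old-non {u} {v} uv with true⊎false (adj G u v)
  ... | inj₁ t = clash (old t) uv
  ... | inj₂ f = f

open Completes

Adj⇒≢ : ∀ {n} (G : Graph n) {u v} → Adj G u v → u ≢ v
Adj⇒≢ G {u} uv refl = clash uv (irrefl G u)

module _ {n : ℕ} (G : Graph n) where

  joins⁻ : ∀ {p : Pair n} {u v} → joins p u v ≡ true → (u ≡ fst p × v ≡ snd p) ⊎ (v ≡ fst p × u ≡ snd p)
  joins⁻ {p} {u} {v} h with ∨-true⁻ {does (u ≟ fst p) ∧ does (v ≟ snd p)} h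
  ... | inj₁ l with ∧-true⁻ {does (u ≟ fst p)} l
  ...   | ua , vb = inj₁ (does-true⁻ (u ≟ fst p) ua , does-true⁻ (v ≟ snd p) vb)
  joins⁻ {p} {u} {v} h | inj₂ r with ∧-true⁻ {does (v ≟ fst p)} r
  ...   | va , ub = inj₂ (does-true⁻ (v ≟ fst p) va , does-true⁻ (u ≟ snd p) ub)

  joins⁺ : ∀ (p : Pair n) → joins p (fst p) (snd p) ≡ true
  joins⁺ p = ∨-true⁺ˡ (∧-true⁺ (does-true⁺ (fst p ≟ fst p) refl) (does-true⁺ (snd p ≟ snd p) refl))

  endpoints : Pair n → Fin n × Fin n
  endpoints p = fst p , snd p

  ⊕-adj⁻ : ∀ A {u v} → Adj (G ⊕ A) u v → Adj G u v ⊎ Joined (map endpoints A) u v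
  ⊕-adj⁻ A {u} {v} h with ∨-true⁻ {adj G u v} h
  ... | inj₁ uv = inj₁ uv
  ... | inj₂ h′ with any-true⁻ A h′
  ...   | p , p∈ , j with joins⁻ {p} {u} {v} j
  ...     | inj₁ (refl , refl) = inj₂ (inj₁ (∈-map⁺ endpoints p∈))
  ...     | inj₂ (refl , refl) = inj₂ (inj₂ (∈-map⁺ endpoints p∈))

  ⊕-adj⁺ : ∀ A {u v} → Adj G u v ⊎ Joined (map endpoints A) u v → Adj (G ⊕ A) u v
  ⊕-adj⁺ A (inj₁ uv) = ∨-true⁺ˡ uv
  ⊕-adj⁺ A {u} {v} (inj₂ (inj₁ j)) with ∈-map⁻ endpoints j
  ... | p , p∈ , refl = ∨-true⁺ʳ {adj G u v} (any-true⁺ p∈ (joins⁺ p))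
  ⊕-adj⁺ A {u} {v} (inj₂ (inj₂ j)) with ∈-map⁻ endpoints j
  ... | p , p∈ , refl = Adj-sym (G ⊕ A) (∨-true⁺ʳ {adj G v u} (any-true⁺ p∈ (joins⁺ p)))

  ⊕-completes : ∀ A → Completes G (map endpoints A) (G ⊕ A)
  ⊕-completes A = record { adj⁻ = ⊕-adj⁻ A ; adj⁺ = λ _ → ⊕-adj⁺ A }

  completes-skip : ∀ {L H a b} → a ≡ b ⊎ Adj H a b → Completes G L H → Completes G ((a , b) ∷ L) H
  completes-skip {L} {H} {a} {b} redundant comp = record
    { adj⁻ = Sum.map₂ (Sum.map there there) ∘ adj⁻ comp
    ; adj⁺ = to redundant
    }
    where
    to : a ≡ b ⊎ Adj H a b → ∀ {u v} → u ≢ v → Adj G u v ⊎ Joined ((a , b) ∷ L) u v → Adj H u v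
    to _           u≢v (inj₁ uv)                = adj⁺ comp u≢v (inj₁ uv)
    to _           u≢v (inj₂ (inj₁ (there j)))  = adj⁺ comp u≢v (inj₂ (inj₁ j))
    to _           u≢v (inj₂ (inj₂ (there j)))  = adj⁺ comp u≢v (inj₂ (inj₂ j))
    to (inj₁ refl) u≢v (inj₂ (inj₁ (here refl))) = ⊥-elim (u≢v refl)
    to (inj₁ refl) u≢v (inj₂ (inj₂ (here refl))) = ⊥-elim (u≢v refl)
    to (inj₂ ab)   u≢v (inj₂ (inj₁ (here refl))) = ab
    to (inj₂ ab)   u≢v (inj₂ (inj₂ (here refl))) = Adj-sym H ab

  completes-insert : ∀ {L} A p → Completes G L (G ⊕ A) → Completes G (endpoints p ∷ L) (G ⊕ (p ∷ A))
  completes-insert {L} A p comp = record { adj⁻ = from ∘ ⊕-adj⁻ (p ∷ A) ; adj⁺ = to }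
    where
    from : ∀ {u v} → Adj G u v ⊎ Joined (map endpoints (p ∷ A)) u v → Adj G u v ⊎ Joined (endpoints p ∷ L) u v
    from (inj₁ uv)               = inj₁ uv
    from (inj₂ (inj₁ (here eq))) = inj₂ (inj₁ (here eq))
    from (inj₂ (inj₂ (here eq))) = inj₂ (inj₂ (here eq))
    from (inj₂ (inj₁ (there j))) = Sum.map₂ (Sum.map there there) (adj⁻ comp (⊕-adj⁺ A (inj₂ (inj₁ j))))
    from (inj₂ (inj₂ (there j))) = Sum.map₂ (Sum.map there there) (adj⁻ comp (⊕-adj⁺ A (inj₂ (inj₂ j))))
    later : ∀ {u v} → Adj (G ⊕ A) u v → Adj (G ⊕ (p ∷ A)) u v
    later uv = ⊕-adj⁺ (p ∷ A) (Sum.map₂ (Sum.map there there) (⊕-adj⁻ A uv))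
    to : ∀ {u v} → u ≢ v → Adj G u v ⊎ Joined (endpoints p ∷ L) u v → Adj (G ⊕ (p ∷ A)) u v
    to u≢v (inj₁ uv)               = later (adj⁺ comp u≢v (inj₁ uv))
    to u≢v (inj₂ (inj₁ (here eq))) = ⊕-adj⁺ (p ∷ A) (inj₂ (inj₁ (here eq)))
    to u≢v (inj₂ (inj₂ (here eq))) = ⊕-adj⁺ (p ∷ A) (inj₂ (inj₂ (here eq)))
    to u≢v (inj₂ (inj₁ (there j))) = later (adj⁺ comp u≢v (inj₂ (inj₁ j)))
    to u≢v (inj₂ (inj₂ (there j))) = later (adj⁺ comp u≢v (inj₂ (inj₂ j)))

  completes-swap : ∀ {L H a b} → Completes G ((a , b) ∷ L) H → Completes G ((b , a) ∷ L) H
  completes-swap comp = record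
    { adj⁻ = Sum.map₂ swap ∘ adj⁻ comp
    ; adj⁺ = λ u≢v → adj⁺ comp u≢v ∘ Sum.map₂ swap
    }
    where
    swap : ∀ {L : List (Fin n × Fin n)} {a b u v} → Joined ((a , b) ∷ L) u v → Joined ((b , a) ∷ L) u v
    swap (inj₁ (here refl)) = inj₂ (here refl)
    swap (inj₁ (there j))   = inj₁ (there j)
    swap (inj₂ (here refl)) = inj₁ (here refl)
    swap (inj₂ (there j))   = inj₂ (there j)

  fresh : ∀ A p → Non (G ⊕ A) (fst p) (snd p) → All (p ≢_) A
  fresh A p ab = ¬Any⇒All¬ A λ p∈ → clash (⊕-adj⁺ A (inj₂ (inj₁ (∈-map⁺ endpoints p∈)))) ab

  -- A pair is retained only if it is new in the graph built so far, which removes loops, edges of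
  -- `G` and repetitions in either orientation.
  normalise : ∀ L → ∃[ A ] Unique A × All (NonAdjacent G) A × length A ≤ length L × Completes G L (G ⊕ A)
  normalise [] = [] , [] , [] , z≤n , ⊕-completes []
  normalise ((a , b) ∷ L) with normalise L
  ... | A , uniq , non , len , comp with true⊎false (adj (G ⊕ A) a b) | <-cmp a b
  ...   | inj₁ ab | _              = A , uniq , non , m≤n⇒m≤1+n len , completes-skip (inj₂ ab) comp
  ...   | inj₂ ab | tri≈ _ a≡b _   = A , uniq , non , m≤n⇒m≤1+n len , completes-skip (inj₁ a≡b) comp
  ...   | inj₂ ab | tri< a<b _ _   = p ∷ A , fresh A p ab ∷ uniq , old-non comp ab ∷ non , s≤s len , completes-insert A p comp
    where p = pair a b a<b
  ...   | inj₂ ab | tri> _ _ b<a   = p ∷ A , fresh A p ba ∷ uniq , old-non comp ba ∷ non , s≤s len ,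
                                     completes-swap (completes-insert A p comp)
    where
    p  = pair b a b<a
    ba = Non-sym (G ⊕ A) ab

ends : ∀ {n} → List (Fin n × Fin n) → List (Fin n)
ends []            = []
ends ((a , b) ∷ L) = a ∷ b ∷ ends L

length-ends : ∀ {n} (L : List (Fin n × Fin n)) → length (ends L) ≡ length L + length L
length-ends []      = refl
length-ends (p ∷ L) = cong suc (trans (cong suc (length-ends L)) (≡-sym (+-suc (length L) (length L))))

joined-end : ∀ {n} {L : List (Fin n × Fin n)} {u v} → Joined L u v → u ∈ ends L
joined-end (inj₁ j) = first j
  where
  first : ∀ {L u v} → (u , v) ∈ L → u ∈ ends L
  first (here refl) = here refl
  first (there j)   = there (there (first j))
joined-end (inj₂ j) = second j
  where
  second : ∀ {L u v} → (u , v) ∈ L → v ∈ ends L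
  second (here refl) = there (here refl)
  second (there j)   = there (there (second j))

untouched : ∀ {n} {G : Graph n} {L H u} → Completes G L H → u ∉ ends L → ∀ v → adj H u v ≡ adj G u v
untouched comp u∉ v = ≡-from-⇔ (λ h → [ id , (λ j → ⊥-elim (u∉ (joined-end j))) ]′ (adj⁻ comp h)) (old comp)

record Solution {n} (G : Graph n) (k : ℕ) : Set where
  field
    additions : List (Fin n × Fin n)
    budgeted  : length additions ≤ k
    result    : Graph n
    completes : Completes G additions result
    free      : PawFree result

solution : ∀ {n} {G : Graph n} {k} → PawFreeEdgeAddition ⟨ G , k ⟩ → Solution G k
solution {G = G} (A , _ , _ , len , free) = record
  { additions = map (endpoints G) A
  ; budgeted  = ≤-trans (≤-reflexive (length-map (endpoints G) A)) len
  ; result    = G ⊕ A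
  ; completes = ⊕-completes G A
  ; free      = free
  }

-- Paw-freeness is asked of every completion, as the set of pairs is only produced by `normalise`.
addition : ∀ {n} {G : Graph n} {k} L → length L ≤ k → (∀ H → Completes G L H → PawFree H) →
  PawFreeEdgeAddition ⟨ G , k ⟩
addition {G = G} L len free with normalise G L
... | A , uniq , non , len′ , comp = A , uniq , non , ≤-trans len′ len , free (G ⊕ A) comp

-- Restriction to an induced subgraph

module _ {m n : ℕ} (ι : Fin m → Fin n) (ι-injective : ∀ {i j} → ι i ≡ ι j → i ≡ j) where

  pull : List (Fin n × Fin n) → List (Fin m × Fin m)
  pull [] = []
  pull ((u , v) ∷ L) with any? (λ i → ι i ≟ u) | any? (λ j → ι j ≟ v)
  ... | yes (i , _) | yes (j , _) = (i , j) ∷ pull L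
  ... | yes _       | no _        = pull L
  ... | no _        | _           = pull L

  length-pull : ∀ L → length (pull L) ≤ length L
  length-pull [] = z≤n
  length-pull ((u , v) ∷ L) with any? (λ i → ι i ≟ u) | any? (λ j → ι j ≟ v)
  ... | yes _ | yes _ = s≤s (length-pull L)
  ... | yes _ | no _  = m≤n⇒m≤1+n (length-pull L)
  ... | no _  | _     = m≤n⇒m≤1+n (length-pull L)

  ∈-pull⁻ : ∀ L {i j} → (i , j) ∈ pull L → (ι i , ι j) ∈ L
  ∈-pull⁻ ((u , v) ∷ L) h with any? (λ i → ι i ≟ u) | any? (λ j → ι j ≟ v)
  ∈-pull⁻ ((u , v) ∷ L) (here refl) | yes (i , refl) | yes (j , refl) = here refl
  ∈-pull⁻ ((u , v) ∷ L) (there h)   | yes _ | yes _ = there (∈-pull⁻ L h)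
  ∈-pull⁻ ((u , v) ∷ L) h           | yes _ | no _  = there (∈-pull⁻ L h)
  ∈-pull⁻ ((u , v) ∷ L) h           | no _  | _     = there (∈-pull⁻ L h)

  ∈-pull⁺ : ∀ L {i j} → (ι i , ι j) ∈ L → (i , j) ∈ pull L
  ∈-pull⁺ ((u , v) ∷ L) {i} {j} h with any? (λ i → ι i ≟ u) | any? (λ j → ι j ≟ v)
  ∈-pull⁺ ((u , v) ∷ L) {i} {j} (here refl) | yes (i′ , eq) | yes (j′ , eq′)
    rewrite ι-injective eq | ι-injective eq′ = here refl
  ∈-pull⁺ ((u , v) ∷ L) {i} {j} (here refl) | yes _ | no ¬j = ⊥-elim (¬j (j , refl))
  ∈-pull⁺ ((u , v) ∷ L) {i} {j} (here refl) | no ¬i | _     = ⊥-elim (¬i (i , refl))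
  ∈-pull⁺ ((u , v) ∷ L) (there h) | yes _ | yes _ = there (∈-pull⁺ L h)
  ∈-pull⁺ ((u , v) ∷ L) (there h) | yes _ | no _  = ∈-pull⁺ L h
  ∈-pull⁺ ((u , v) ∷ L) (there h) | no _  | _     = ∈-pull⁺ L h

  -- Paw-freeness is hereditary, and the pulled-back pairs complete the induced subgraph of `G` to
  -- that of `H`.
  restrict : ∀ {G : Graph n} {k} → PawFreeEdgeAddition ⟨ G , k ⟩ → PawFreeEdgeAddition ⟨ induced G ι , k ⟩
  restrict {G} solvable = addition {G = induced G ι} (pull L) (≤-trans (length-pull L) budgeted) λ H′ comp copy →
    let isPaw ab bc ac cd ad bd = copy⇒paw copy
        down : ∀ {i j} → Adj H′ i j → Adj H (ι i) (ι j)
        down ij = adj⁺ completes (λ eq → Adj⇒≢ H′ ij (ι-injective eq))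
          (Sum.map₂ (Sum.map (∈-pull⁻ L) (∈-pull⁻ L)) (adj⁻ comp ij))
        up : ∀ {i j} → Adj H (ι i) (ι j) → Adj H′ i j
        up ij = adj⁺ comp (λ { refl → Adj⇒≢ H ij refl })
          (Sum.map₂ (Sum.map (∈-pull⁺ L) (∈-pull⁺ L)) (adj⁻ completes ij))
        down-non : ∀ {i j} → Non H′ i j → Non H (ι i) (ι j)
        down-non = trans (≡-from-⇔ up down)
    in free (paw⇒copy (isPaw (down ab) (down bc) (down ac) (down cd) (down-non ad) (down-non bd)))
    where
    open Solution (solution {G = G} solvable) renaming (additions to L; result to H)

≤ᵇ-true⁻ : ∀ {i j} → (i ≤ᵇ j) ≡ true → i ≤ j
≤ᵇ-true⁻ {i} {j} h = ≤ᵇ⇒≤ i j (subst T (≡-sym h) tt)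

≤ᵇ-false⁻ : ∀ {i j} → (i ≤ᵇ j) ≡ false → j < i
≤ᵇ-false⁻ h = ≰⇒> λ le → subst T h (≤⇒≤ᵇ le)

-- Greedy selection

module Selection {n : ℕ} (near : Fin n → Bool) (alike twin : Rel n) (k : ℕ)
  (alike-sym : ∀ {u v} → alike u v ≡ true → alike v u ≡ true)
  (twin-cong : ∀ {u v} → twin u v ≡ true → ∀ w → twin u w ≡ twin v w)
  where

  admissible : Fin n → List (Fin n) → Bool
  admissible u S = near u ∧ (not (any (alike u) S) ∧ (count (twin u) S ≤ᵇ k + k))

  select : List (Fin n) → List (Fin n)
  select = foldr (λ u S → ifᵇ admissible u S then u ∷ S else S) []

  select-⊆ : ∀ us {v} → v ∈ select us → v ∈ us
  select-⊆ (u ∷ us) v∈ with admissible u (select us)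
  select-⊆ (u ∷ us) (here refl) | true = here refl
  select-⊆ (u ∷ us) (there v∈)  | true = there (select-⊆ us v∈)
  select-⊆ (u ∷ us) v∈          | false = there (select-⊆ us v∈)

  select-near : ∀ us {v} → v ∈ select us → near v ≡ true
  select-near (u ∷ us) v∈ with admissible u (select us) in adm
  select-near (u ∷ us) (here refl) | true  = proj₁ (∧-true⁻ adm)
  select-near (u ∷ us) (there v∈)  | true  = select-near us v∈
  select-near (u ∷ us) v∈          | false = select-near us v∈

  select-unique : ∀ {us} → Unique us → Unique (select us)
  select-unique [] = []
  select-unique {u ∷ us} (u∉ ∷ uniq) with admissible u (select us)
  ... | true  = All.tabulate (λ v∈ → All.lookup u∉ (select-⊆ us v∈)) ∷ select-unique uniq
  ... | false = select-unique uniq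

  select-alike : ∀ us {u v} → u ∈ select us → v ∈ select us → alike u v ≡ true → u ≡ v
  select-alike (w ∷ us) u∈ v∈ uv with admissible w (select us) in adm
  select-alike (w ∷ us) u∈          v∈          uv | false = select-alike us u∈ v∈ uv
  select-alike (w ∷ us) (there u∈)  (there v∈)  uv | true  = select-alike us u∈ v∈ uv
  select-alike (w ∷ us) (here refl) (here refl) uv | true  = refl
  select-alike (w ∷ us) (here refl) (there v∈)  uv | true  =
    clash uv (any-false⁻ (not-true⁻ (proj₁ (∧-true⁻ (proj₂ (∧-true⁻ {near w} adm))))) v∈)
  select-alike (w ∷ us) (there u∈)  (here refl) uv | true  =
    clash (alike-sym uv) (any-false⁻ (not-true⁻ (proj₁ (∧-true⁻ (proj₂ (∧-true⁻ {near w} adm))))) u∈)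

  -- A class grows only while it has at most `2k` members; `twin-cong` makes the count independent
  -- of which twin asks.
  select-twins : ∀ us v → count (twin v) (select us) ≤ suc (k + k)
  select-twins []       v = z≤n
  select-twins (u ∷ us) v with admissible u (select us) in adm
  ... | false = select-twins us v
  ... | true with twin v u in vu
  ...   | false = select-twins us v
  ...   | true  = s≤s (subst (_≤ k + k) (count-cong (select us) (≡-sym ∘ twin-cong vu))
                    (≤ᵇ-true⁻ (proj₂ (∧-true⁻ (proj₂ (∧-true⁻ {near u} adm))))))

  -- The selection only grows after a vertex is refused, so the reason for the refusal persists.
  select-maximal : ∀ us {v} → v ∈ us → near v ≡ true → v ∉ select us →
    (∃[ w ] w ∈ select us × alike v w ≡ true) ⊎ k + k < count (twin v) (select us)
  select-maximal (u ∷ us) v∈ nv v∉ with admissible u (select us) in adm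
  select-maximal (u ∷ us) (here refl) nv v∉ | true  = ⊥-elim (v∉ (here refl))
  select-maximal (u ∷ us) {v} (there v∈)  nv v∉ | true  with select-maximal us v∈ nv (v∉ ∘ there)
  ... | inj₁ (w , w∈ , vw) = inj₁ (w , there w∈ , vw)
  ... | inj₂ many          = inj₂ (≤-trans many (count-∷ (twin v) u (select us)))
  select-maximal (u ∷ us) (there v∈)  nv v∉ | false = select-maximal us v∈ nv v∉
  select-maximal (u ∷ us) (here refl) nv v∉ | false
    with true⊎false (any (alike u) (select us)) | true⊎false (count (twin u) (select us) ≤ᵇ k + k)
  ... | inj₁ found | _ = inj₁ (any-true⁻ (select us) found)
  ... | inj₂ _     | inj₂ many  = inj₂ (≤ᵇ-false⁻ many)
  ... | inj₂ none  | inj₁ room = clash (∧-true⁺ nv (∧-true⁺ (not-true⁺ none) room)) adm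

-- Connectivity

module _ {n : ℕ} where

  -- The invariant of Warshall's algorithm: transitivity through the vertices processed so far.
  Warshall-Closed : List (Fin n) → Rel n → Set
  Warshall-Closed ws R = ∀ {w u v} → w ∈ ws → R u w ≡ true → R w v ≡ true → R u v ≡ true

  warshall-incl : ∀ ws (R : Rel n) {u v} → R u v ≡ true → warshall ws R u v ≡ true
  warshall-incl []       R uv = uv
  warshall-incl (w ∷ ws) R uv = warshall-incl ws (via w R) (∨-true⁺ˡ uv)

  via-sym : ∀ w (R : Rel n) → (∀ u v → R u v ≡ R v u) → ∀ u v → via w R u v ≡ via w R v u
  via-sym w R sy u v = cong₂ _∨_ (sy u v) (trans (∧-comm (R u w) (R w v)) (cong₂ _∧_ (sy w v) (sy u w)))

  warshall-sym : ∀ ws (R : Rel n) → (∀ u v → R u v ≡ R v u) → ∀ u v → warshall ws R u v ≡ warshall ws R v u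
  warshall-sym []       R sy = sy
  warshall-sym (w ∷ ws) R sy = warshall-sym ws (via w R) (via-sym w R sy)

  -- Leastness of the closure, phrased as an induction principle; it takes the place of paths
  -- everywhere below.
  warshall-min : ∀ ws (R : Rel n) (P : Fin n → Set) → (∀ {u v} → R u v ≡ true → P u → P v) →
    ∀ {u v} → warshall ws R u v ≡ true → P u → P v
  warshall-min []       R P closed uv = closed uv
  warshall-min (w ∷ ws) R P closed uv = warshall-min ws (via w R) P closed′ uv
    where
    closed′ : ∀ {u v} → via w R u v ≡ true → P u → P v
    closed′ {u} {v} h with ∨-true⁻ {R u v} h
    ... | inj₁ uv = closed uv
    ... | inj₂ h′ = let uw , wv = ∧-true⁻ h′ in closed wv ∘ closed uw

  via-closed : ∀ {ws w} {R : Rel n} → Warshall-Closed ws R → Warshall-Closed (w ∷ ws) (via w R)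
  via-closed {ws} {w} {R} closed {u = u} {v} = go
    where
    R? : ∀ u v → via w R u v ≡ true → R u v ≡ true ⊎ (R u w ≡ true × R w v ≡ true)
    R? u v = Sum.map₂ ∧-true⁻ ∘ ∨-true⁻ {R u v}
    direct : R u v ≡ true → via w R u v ≡ true
    direct = ∨-true⁺ˡ
    through : R u w ≡ true → R w v ≡ true → via w R u v ≡ true
    through uw wv = ∨-true⁺ʳ {R u v} (∧-true⁺ uw wv)
    go : ∀ {x} → x ∈ w ∷ ws → via w R u x ≡ true → via w R x v ≡ true → via w R u v ≡ true
    go {x} x∈ ux xv with R? u x ux | R? x v xv
    go (here refl) _ _ | inj₁ uw       | inj₁ wv       = through uw wv
    go (there x∈)  _ _ | inj₁ ux       | inj₁ xv       = direct (closed x∈ ux xv)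
    go (here refl) _ _ | inj₁ uw       | inj₂ (_ , wv) = through uw wv
    go (there x∈)  _ _ | inj₁ ux       | inj₂ (xw , wv) = through (closed x∈ ux xw) wv
    go (here refl) _ _ | inj₂ (uw , _) | inj₁ wv       = through uw wv
    go (there x∈)  _ _ | inj₂ (uw , wx) | inj₁ xv      = through uw (closed x∈ wx xv)
    go _           _ _ | inj₂ (uw , _) | inj₂ (_ , wv) = through uw wv

  warshall-closed : ∀ {vs} ws {R : Rel n} → Warshall-Closed vs R →
    ∀ {w} → w ∈ vs ⊎ w ∈ ws → ∀ {u v} → warshall ws R u w ≡ true → warshall ws R w v ≡ true → warshall ws R u v ≡ true
  warshall-closed []       closed (inj₁ w∈) = closed w∈
  warshall-closed (x ∷ ws) closed (inj₁ w∈)          = warshall-closed ws (via-closed closed) (inj₁ (there w∈))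
  warshall-closed (x ∷ ws) closed (inj₂ (here refl)) = warshall-closed ws (via-closed closed) (inj₁ (here refl))
  warshall-closed (x ∷ ws) closed (inj₂ (there w∈))  = warshall-closed ws (via-closed closed) (inj₂ w∈)

∈-allVertices : ∀ {n} (v : Fin n) → v ∈ allVertices n
∈-allVertices v = reverse⁺ (∈-allFin v)

-- Connectivity, twins, clean vertices and nearness to a paw

module Relations {n : ℕ} (G : Graph n) where

  private
    vs : List (Fin n)
    vs = allVertices n

  -- Written so as to agree by computation with the formulas of the kernel; `Kept` relies on this to
  -- apply the lemmas on `select` to `kept`.
  conn twin cleanPair : Rel n
  clean nearPaw : Fin n → Bool
  conn          = warshall vs (adj G)
  twin u v      = not (any (λ z → (adj G u z ∧ not (adj G v z)) ∨ (not (adj G u z) ∧ adj G v z)) vs)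
  clean u       = not (any (λ w → conn u w ∧ (not (adj G u w) ∧ not (twin u w))) vs)
  cleanPair u v = clean u ∧ (clean v ∧ conn u v)
  nearPaw u     = any (λ d → any (λ c → any (λ b → any (λ a →
    adj G a b ∧ (adj G b c ∧ (adj G a c ∧ (adj G c d ∧ (not (adj G a d) ∧ (not (adj G b d) ∧ conn u a))))))
    vs) vs) vs) vs

  -- Conn and Near are records so that their indices can be inferred.
  record Conn (u v : Fin n) : Set where
    constructor connected
    field conn-true : conn u v ≡ true

  open Conn public

  Twin : Fin n → Fin n → Set
  Twin u v = ∀ z → adj G u z ≡ adj G v z

  Clean : Fin n → Set
  Clean u = clean u ≡ true

  record Near (u : Fin n) : Set where
    constructor near
    field near-true : nearPaw u ≡ true

  open Near public

  abstract

    conn-adj : ∀ {u v} → Adj G u v → Conn u v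
    conn-adj {u} {v} uv = connected (warshall-incl vs (adj G) {u} {v} uv)

    conn-sym : ∀ {u v} → Conn u v → Conn v u
    conn-sym {u} {v} (connected uv) = connected (trans (warshall-sym vs (adj G) (Graph.sym G) v u) uv)

    conn-trans : ∀ {u v w} → Conn u v → Conn v w → Conn u w
    conn-trans {u} {v} {w} (connected uv) (connected vw) =
      connected (warshall-closed {vs = []} vs {adj G} (λ ()) {v} (inj₂ (∈-allVertices v)) {u} {w} uv vw)

    conn-min : ∀ (P : Fin n → Set) → (∀ {u v} → Adj G u v → P u → P v) → ∀ {u v} → Conn u v → P u → P v
    conn-min P closed {u} {v} (connected uv) = warshall-min vs (adj G) P closed {u} {v} uv

    twin⁻ : ∀ {u v} → twin u v ≡ true → Twin u v
    twin⁻ {u} {v} h z with adj G u z | adj G v z | any-false⁻ (not-true⁻ h) (∈-allVertices z)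
    ... | true  | true  | _ = refl
    ... | false | false | _ = refl

    twin-false⁻ : ∀ {u v} → twin u v ≡ false → ∃[ z ] ((Adj G u z × Non G v z) ⊎ (Non G u z × Adj G v z))
    twin-false⁻ {u} {v} h with any-true⁻ vs (not-false⁻ h)
    ... | z , _ , h′ with ∨-true⁻ {adj G u z ∧ not (adj G v z)} h′
    ...   | inj₁ l = let uz , vz = ∧-true⁻ l in z , inj₁ (uz , not-true⁻ vz)
    ...   | inj₂ r = let uz , vz = ∧-true⁻ r in z , inj₂ (not-true⁻ uz , vz)

    twin⁺ : ∀ {u v} → Twin u v → twin u v ≡ true
    twin⁺ {u} {v} t with true⊎false (twin u v)
    ... | inj₁ h = h
    ... | inj₂ h with twin-false⁻ h
    ...   | z , inj₁ (uz , vz) = clash (trans (≡-sym (t z)) uz) vz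
    ...   | z , inj₂ (uz , vz) = clash (trans (t z) vz) uz

    twin-cong : ∀ {u v} → twin u v ≡ true → ∀ w → twin u w ≡ twin v w
    twin-cong uv w = ≡-from-⇔
      (λ uw → twin⁺ λ z → trans (≡-sym (twin⁻ uv z)) (twin⁻ uw z))
      (λ vw → twin⁺ λ z → trans (twin⁻ uv z) (twin⁻ vw z))

    Twin-sym : ∀ {u v} → Twin u v → Twin v u
    Twin-sym t z = ≡-sym (t z)

    clean⁻ : ∀ {u w} → Clean u → Conn u w → Non G u w → Twin u w
    clean⁻ {u} {w} cu uw non with true⊎false (twin u w)
    ... | inj₁ t = twin⁻ t
    ... | inj₂ t = clash (∧-true⁺ (conn-true uw) (∧-true⁺ (not-true⁺ non) (not-true⁺ t)))
                         (any-false⁻ (not-true⁻ cu) (∈-allVertices w))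

    unclean⁻ : ∀ {u} → clean u ≡ false → ∃[ w ] Conn u w × Non G u w × twin u w ≡ false
    unclean⁻ h with any-true⁻ vs (not-false⁻ h)
    ... | w , _ , h′ with ∧-true⁻ h′
    ...   | uw , h″ with ∧-true⁻ h″
    ...     | non , t = w , connected uw , not-true⁻ non , not-true⁻ t

    clean⁺ : ∀ {u} → (∀ {w} → Conn u w → Non G u w → Twin u w) → Clean u
    clean⁺ {u} h with true⊎false (clean u)
    ... | inj₁ cu = cu
    ... | inj₂ cu with unclean⁻ cu
    ...   | w , uw , non , t = clash (twin⁺ (h uw non)) t

    twin-clean : ∀ {u v} → Conn u v → Twin u v → Clean u → Clean v
    twin-clean uv t cu = clean⁺ λ {w} vw non z →
      trans (≡-sym (t z)) (clean⁻ cu (conn-trans uv vw) (trans (t w) non) z)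

    cleanPair⁺ : ∀ {u v} → Clean u → Clean v → Conn u v → cleanPair u v ≡ true
    cleanPair⁺ cu cv uv = ∧-true⁺ cu (∧-true⁺ cv (conn-true uv))

    cleanPair⁻ : ∀ {u v} → cleanPair u v ≡ true → Clean u × Clean v × Conn u v
    cleanPair⁻ {u} {v} h with ∧-true⁻ {clean u} h
    ... | cu , h′ with ∧-true⁻ {clean v} h′
    ...   | cv , uv = cu , cv , connected uv

    cleanPair-sym : ∀ {u v} → cleanPair u v ≡ true → cleanPair v u ≡ true
    cleanPair-sym {u} {v} h with cleanPair⁻ {u} {v} h
    ... | cu , cv , uv = cleanPair⁺ cv cu (conn-sym uv)

    near⁻ : ∀ {u} → Near u → ∃[ a ] ∃[ b ] ∃[ c ] ∃[ d ] IsPaw G a b c d × Conn u a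
    near⁻ (near h) with any-true⁻ vs h
    ... | d , _ , h₁ with any-true⁻ vs h₁
    ... | c , _ , h₂ with any-true⁻ vs h₂
    ... | b , _ , h₃ with any-true⁻ vs h₃
    ... | a , _ , h₄ with ∧-true⁻ {adj G a b} h₄
    ... | ab , h₅ with ∧-true⁻ {adj G b c} h₅
    ... | bc , h₆ with ∧-true⁻ {adj G a c} h₆
    ... | ac , h₇ with ∧-true⁻ {adj G c d} h₇
    ... | cd , h₈ with ∧-true⁻ {not (adj G a d)} h₈
    ... | ad , h₉ with ∧-true⁻ {not (adj G b d)} h₉
    ... | bd , ua = a , b , c , d , isPaw ab bc ac cd (not-true⁻ ad) (not-true⁻ bd) , connected ua

    near⁺ : ∀ {u a b c d} → IsPaw G a b c d → Conn u a → Near u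
    near⁺ {u} {a} {b} {c} {d} (isPaw ab bc ac cd ad bd) ua = near (
      exists⁺ (λ d → exists λ c → exists λ b → exists λ a → paw? a b c d) d
      (exists⁺ (λ c → exists λ b → exists λ a → paw? a b c d) c
      (exists⁺ (λ b → exists λ a → paw? a b c d) b
      (exists⁺ (λ a → paw? a b c d) a
        (∧-true⁺ ab (∧-true⁺ bc (∧-true⁺ ac (∧-true⁺ cd
          (∧-true⁺ (not-true⁺ ad) (∧-true⁺ (not-true⁺ bd) (conn-true ua)))))))))))
      where
      exists : (Fin n → Bool) → Bool
      exists p = any p vs
      exists⁺ : ∀ p v → p v ≡ true → exists p ≡ true
      exists⁺ p v = any-true⁺ (∈-allVertices v)
      paw? : Fin n → Fin n → Fin n → Fin n → Bool
      paw? a b c d = adj G a b ∧ (adj G b c ∧ (adj G a c ∧ (adj G c d ∧ (not (adj G a d) ∧ (not (adj G b d) ∧ conn u a)))))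

    near-conn : ∀ {u v} → Conn u v → Near u → Near v
    near-conn uv nu = let _ , _ , _ , _ , p , ua = near⁻ nu in near⁺ p (conn-trans (conn-sym uv) ua)

    -- `conn` is not reflexive at isolated vertices, so reflexivity is obtained by a detour through
    -- the paw.
    near-refl : ∀ {u} → Near u → Conn u u
    near-refl nu = let _ , _ , _ , _ , _ , ua = near⁻ nu in conn-trans ua (conn-sym ua)

    near-neighbour : ∀ {u} → Near u → ∃[ z ] Adj G u z
    near-neighbour nu = let _ , b , _ , _ , p , ua = near⁻ nu in
      conn-min (λ v → ∃[ z ] Adj G v z) (λ {u} uv _ → u , Adj-sym G uv) (conn-sym ua) (b , IsPaw.ab p)

    -- Twins near a paw share a neighbour.
    twin-conn : ∀ {u v} → Near u → Twin u v → Conn u v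
    twin-conn nu t = let z , uz = near-neighbour nu in
      conn-trans (conn-adj uz) (conn-sym (conn-adj (trans (≡-sym (t z)) uz)))

module Kept {n : ℕ} (G : Graph n) (k : ℕ) where

  open Relations G public
  open Selection nearPaw cleanPair twin k cleanPair-sym twin-cong

  S : List (Fin n)
  S = kept G k

  abstract

    S-unique : Unique S
    S-unique = select-unique (allFin⁺ n)

    S-near : ∀ {v} → v ∈ S → Near v
    S-near = near ∘ select-near (allFin n)

    S-clean : ∀ {u v} → u ∈ S → v ∈ S → Clean u → Clean v → Conn u v → u ≡ v
    S-clean u∈ v∈ cu cv uv = select-alike (allFin n) u∈ v∈ (cleanPair⁺ cu cv uv)

    S-twins : ∀ v → count (twin v) S ≤ suc (k + k)
    S-twins = select-twins (allFin n)

    S-maximal : ∀ {v} → Near v → v ∉ S →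
      (∃[ w ] w ∈ S × Clean v × Clean w × Conn v w) ⊎ k + k < count (twin v) S
    S-maximal {v} nv v∉ = Sum.map₁ (λ (w , w∈ , vw) → w , w∈ , cleanPair⁻ {v} {w} vw)
      (select-maximal (allFin n) (∈-allFin v) (near-true nv) v∉)

-- A solvable instance has few kept vertices

module Size {n : ℕ} (G : Graph n) (k : ℕ) (sol : Solution G k) where

  open Kept G k
  open Solution sol renaming (additions to L; result to H)

  E : List (Fin n)
  E = ends L

  fixed : ∀ {u} → u ∉ E → ∀ v → adj H u v ≡ adj G u v
  fixed = untouched completes

  -- The component of `x` in `G` is connected by edges that survive in `H`, and a paw in it supplies
  -- the triangle. Pairs added between components do no harm.
  multipartite : ∀ {x p q r} → Near x → Conn x p → Conn x q → Conn x r →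
    Adj H p q → Non H p r → Non H q r → ⊥
  multipartite {x} nx = let _ , _ , _ , _ , isPaw ab bc ac _ _ _ , xa = near⁻ nx in
    Multipartite.multipartite H free (Conn x)
      (λ P closed cu cv → conn-min P (closed ∘ old completes) (conn-trans (conn-sym cu) cv))
      (old completes ab , old completes bc , old completes ac) xa

  -- The vertex v is charged to the endpoint e of an added edge.
  equal charge-clean charge-twin charge : Fin n → Fin n → Bool
  equal e v        = does (v ≟ e)
  charge-clean e v = clean v ∧ conn v e
  charge-twin e v  = not (does (v ∈? E)) ∧ (not (adj H v e) ∧ conn v e)
  charge e v       = equal e v ∨ (charge-clean e v ∨ charge-twin e v)

  charge-twin⁺ : ∀ {e v} → v ∉ E → Non H v e → Conn v e → charge-twin e v ≡ true
  charge-twin⁺ {e} {v} v∉ ve cve with v ∈? E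
  ... | yes v∈ = ⊥-elim (v∉ v∈)
  ... | no _   = ∧-true⁺ (not-true⁺ ve) (conn-true cve)

  charge-twin⁻ : ∀ {e v} → charge-twin e v ≡ true → v ∉ E × Non H v e × Conn v e
  charge-twin⁻ {e} {v} h with v ∈? E
  ... | no v∉ = let ve , cve = ∧-true⁻ h in v∉ , not-true⁻ ve , connected cve

  Charged : Fin n → Set
  Charged v = ∃[ e ] e ∈ E × charge e v ≡ true

  module _ {v} (v∈S : v ∈ S) (v∉ : v ∉ E) where

    nv : Near v
    nv = S-near v∈S

    -- A paw of the component is only destroyed by adding `ad` or `bd`, so `a` or `b` is an
    -- endpoint.
    when-clean : Clean v → Charged v
    when-clean cv = touched (near⁻ nv)
      where
      charged : ∀ {e} → e ∈ E → Conn v e → Charged v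
      charged {e} e∈ ve = e , e∈ , ∨-true⁺ʳ {equal e v} (∨-true⁺ˡ (∧-true⁺ cv (conn-true ve)))
      touched : ∃[ a ] ∃[ b ] ∃[ c ] ∃[ d ] IsPaw G a b c d × Conn v a → Charged v
      touched (a , b , c , d , isPaw ab bc ac cd ad bd , va) with a ∈? E | b ∈? E
      ... | yes a∈ | _      = charged a∈ va
      ... | no _   | yes b∈ = charged b∈ (conn-trans va (conn-adj ab))
      ... | no a∉  | no b∉  = ⊥-elim (free (paw⇒copy (isPaw
              (old completes ab) (old completes bc) (old completes ac) (old completes cd)
              (trans (fixed a∉ d) ad) (trans (fixed b∉ d) bd))))

    -- The witness `w` must be an endpoint. Otherwise `v` and `w` both keep their neighbours, and a
    -- vertex `z` adjacent to just one of them yields an edge that misses the other.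
    when-unclean : ∃[ w ] Conn v w × Non G v w × twin v w ≡ false → Charged v
    when-unclean (w , vw , non , distinct) with w ∈? E
    ... | yes w∈ = w , w∈ , ∨-true⁺ʳ {equal w v} (∨-true⁺ʳ {charge-clean w v} (charge-twin⁺ v∉ (trans (fixed v∉ w) non) vw))
    ... | no w∉  = ⊥-elim (separated (twin-false⁻ {v} {w} distinct))
      where
      separated : ∃[ z ] ((Adj G v z × Non G w z) ⊎ (Non G v z × Adj G w z)) → ⊥
      separated (z , inj₁ (vz , wz)) = multipartite nv (near-refl nv) (conn-adj vz) vw
        (old completes vz) (trans (fixed v∉ w) non) (Non-sym H (trans (fixed w∉ z) wz))
      separated (z , inj₂ (vz , wz)) = multipartite nv vw (conn-trans vw (conn-adj wz)) (near-refl nv)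
        (old completes wz) (Non-sym H (trans (fixed v∉ w) non)) (Non-sym H (trans (fixed v∉ z) vz))

  covered : ∀ {v} → v ∈ S → Charged v
  covered {v} v∈S = case v ∈? E of λ
    { (yes v∈) → v , v∈ , ∨-true⁺ˡ (does-true⁺ (v ≟ v) refl)
    ; (no v∉)  → [ when-clean v∈S v∉ , (λ cv → when-unclean v∈S v∉ (unclean⁻ cv)) ]′ (true⊎false (clean v))
    }

  -- Both vertices lie in the part of `e`, so within the component they have the same neighbours in
  -- `H`; being untouched, they have the same neighbours in `G`.
  charge-twin-twins : ∀ {e u v} → Near u → charge-twin e u ≡ true → charge-twin e v ≡ true → Twin u v
  charge-twin-twins {e} {u} {v} nu hu hv =
    let u∉ , ue , cue = charge-twin⁻ {e} {u} hu
        v∉ , ve , cve = charge-twin⁻ {e} {v} hv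
    in twins u∉ ue cue v∉ ve cve
    where
    module _ (u∉ : u ∉ E) (ue : Non H u e) (cue : Conn u e) (v∉ : v ∉ E) (ve : Non H v e) (cve : Conn v e) where
      cuv : Conn u v
      cuv = conn-trans cue (conn-sym cve)
      twins : Twin u v
      twins z with true⊎false (adj G u z) | true⊎false (adj G v z)
      ... | inj₁ uz | inj₁ vz = trans uz (≡-sym vz)
      ... | inj₂ uz | inj₂ vz = trans uz (≡-sym vz)
      ... | inj₁ uz | inj₂ vz with true⊎false (adj H e z)
      ...   | inj₁ ez = ⊥-elim (multipartite nu cue (conn-adj uz) cuv ez (Non-sym H ve) (Non-sym H (trans (fixed v∉ z) vz)))
      ...   | inj₂ ez = ⊥-elim (multipartite nu (near-refl nu) (conn-adj uz) cue (old completes uz) ue (Non-sym H ez))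
      twins z | inj₂ uz | inj₁ vz with true⊎false (adj H e z)
      ...   | inj₁ ez = ⊥-elim (multipartite nu cue (conn-trans cuv (conn-adj vz)) (near-refl nu)
              ez (Non-sym H ue) (Non-sym H (trans (fixed u∉ z) uz)))
      ...   | inj₂ ez = ⊥-elim (multipartite nu cuv (conn-trans cuv (conn-adj vz)) cue (old completes vz) ve (Non-sym H ez))

  count-charge : ∀ e → count (charge e) S ≤ 1 + (1 + suc (k + k))
  count-charge e = ≤-trans
    (count-cover {q = equal e} {r = λ v → charge-clean e v ∨ charge-twin e v} S (λ {v} _ → ∨-true⁻ {equal e v}))
    (+-mono-≤ equals (≤-trans
      (count-cover {q = charge-clean e} {r = charge-twin e} S (λ {v} _ → ∨-true⁻ {charge-clean e v}))
      (+-mono-≤ cleans twins)))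
    where
    equals : count (equal e) S ≤ 1
    equals = count-≤1 S-unique λ {u} {v} _ _ hu hv → trans (does-true⁻ (u ≟ e) hu) (≡-sym (does-true⁻ (v ≟ e) hv))

    cleans : count (charge-clean e) S ≤ 1
    cleans = count-≤1 S-unique λ {u} {v} u∈ v∈ hu hv →
      let cu , ue = ∧-true⁻ {clean u} hu
          cv , ve = ∧-true⁻ {clean v} hv
      in S-clean u∈ v∈ cu cv (conn-trans (connected ue) (conn-sym (connected ve)))

    twins : count (charge-twin e) S ≤ suc (k + k)
    twins with count (charge-twin e) S in eq
    ... | zero  = z≤n
    ... | suc c = let u , u∈ , hu = count>0 {p = charge-twin e} S (subst (0 <_) (≡-sym eq) (s≤s z≤n)) in
      subst (_≤ suc (k + k)) eq (≤-trans
        (count-mono S (λ {v} _ hv → twin⁺ (charge-twin-twins {e} {u} {v} (S-near u∈) hu hv)))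
        (S-twins u))

  size-bound : length S ≤ limit k
  size-bound = begin
    length S                              ≡⟨ count-const-true S ⟨
    count (λ _ → true) S                  ≤⟨ cover-bound charge E S (λ _ → true)
                                               (λ {e} _ → count-charge e) (λ v∈ _ → covered v∈) ⟩
    length E * (1 + (1 + suc (k + k)))    ≤⟨ *-monoˡ-≤ (1 + (1 + suc (k + k)))
                                               (≤-trans (≤-reflexive (length-ends L)) (+-mono-≤ budgeted budgeted)) ⟩
    (k + k) * (1 + (1 + suc (k + k)))     ≡⟨ arithmetic k ⟩
    limit k                               ∎
    where
    open ≤-Reasoning
    arithmetic : ∀ k → (k + k) * (1 + (1 + suc (k + k))) ≡ k * (k + (k + (k + (k + 6))))
    arithmetic = solve-∀

T⁺ : ∀ {b} → b ≡ true → T b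
T⁺ refl = tt

T⁻ : ∀ {b} → T b → b ≡ true
T⁻ {true} _ = refl

-- Solutions of the subgraph induced by the kept vertices extend to the whole graph

module Lift {n : ℕ} (G : Graph n) (k : ℕ) {m : ℕ} (ι : Fin m → Fin n)
  (ι-injective : ∀ {i j} → ι i ≡ ι j → i ≡ j)
  (ι∈S : ∀ i → ι i ∈ kept G k)
  (index : ∀ {v} → v ∈ kept G k → ∃[ i ] ι i ≡ v)
  (sol : Solution (induced G ι) k)
  where

  open Kept G k
  open Solution sol renaming (additions to L; result to H)

  fixed : ∀ {i} → i ∉ ends L → ∀ j → adj H i j ≡ adj G (ι i) (ι j)
  fixed = untouched completes

  -- Added edges inside one component and between unclean vertices suffice.
  useful : Fin n × Fin n → Bool
  useful (u , v) = conn u v ∧ (not (clean u) ∧ not (clean v))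

  ι² : Fin m × Fin m → Fin n × Fin n
  ι² (i , j) = ι i , ι j

  L′ : List (Fin n × Fin n)
  L′ = filterᵇ useful (map ι² L)

  length-L′ : length L′ ≤ k
  length-L′ = ≤-trans (length-filter _ (map ι² L)) (≤-trans (≤-reflexive (length-map ι² L)) budgeted)

  Useful : Fin n → Fin n → Set
  Useful u v = Conn u v × clean u ≡ false × clean v ≡ false

  Useful-sym : ∀ {u v} → Useful u v → Useful v u
  Useful-sym (uv , cu , cv) = conn-sym uv , cv , cu

  ∈-L′⁻ : ∀ {u v} → (u , v) ∈ L′ → (∃[ i ] ∃[ j ] ι i ≡ u × ι j ≡ v × (i , j) ∈ L) × Useful u v
  ∈-L′⁻ {u} {v} h with ∈-filter⁻ (T? ∘ useful) {xs = map ι² L} h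
  ... | h′ , t with ∈-map⁻ ι² h′ | ∧-true⁻ {conn u v} (T⁻ t)
  ...   | (i , j) , ij , refl | uv , c = let cu , cv = ∧-true⁻ c in
    (i , j , refl , refl , ij) , connected uv , not-true⁻ cu , not-true⁻ cv

  ∈-L′⁺ : ∀ {i j} → (i , j) ∈ L → Useful (ι i) (ι j) → (ι i , ι j) ∈ L′
  ∈-L′⁺ ij (uv , cu , cv) = ∈-filter⁺ (T? ∘ useful) (∈-map⁺ ι² ij)
    (T⁺ (∧-true⁺ (conn-true uv) (∧-true⁺ (not-true⁺ cu) (not-true⁺ cv))))

  joined-L′⁻ : ∀ {u v} → Joined L′ u v → (∃[ i ] ∃[ j ] ι i ≡ u × ι j ≡ v × Joined L i j) × Useful u v
  joined-L′⁻ (inj₁ h) = let (i , j , iu , jv , ij) , uv = ∈-L′⁻ h in (i , j , iu , jv , inj₁ ij) , uv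
  joined-L′⁻ (inj₂ h) = let (i , j , iv , ju , ij) , vu = ∈-L′⁻ h in (j , i , ju , iv , inj₂ ij) , Useful-sym vu

  joined-L′⁺ : ∀ {i j} → Joined L i j → Useful (ι i) (ι j) → Joined L′ (ι i) (ι j)
  joined-L′⁺ (inj₁ h) uv = inj₁ (∈-L′⁺ h uv)
  joined-L′⁺ (inj₂ h) uv = inj₂ (∈-L′⁺ h (Useful-sym uv))

  -- The last two constructors answer the two reasons for refusing a vertex. A representing twin has
  -- to be untouched, so that its neighbours in `H` are those in `G` and `v` can copy it.
  data Rep (v : Fin n) (i : Fin m) : Set where
    itself   : ι i ≡ v → Rep v i
    by-clean : v ∉ S → Clean v → Clean (ι i) → Conn v (ι i) → Rep v i
    by-twin  : v ∉ S → Twin v (ι i) → i ∉ ends L → Rep v i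

  rep : ∀ {v} → Near v → ∃[ i ] Rep v i
  rep {v} nv = case v ∈? S of λ
    { (yes v∈) → let i , iv = index v∈ in i , itself iv
    ; (no v∉)  → [ (λ { (w , w∈ , cv , cw , vw) → clean-rep v∉ cv cw vw (index w∈) })
                 -- More than `2k` twins are kept, while at most `2k` vertices are endpoints.
                 , (λ many → twin-rep v∉ (pigeonhole (map ι (ends L)) S-unique (<-≤-trans (s≤s few-ends) many)))
                 ]′ (S-maximal nv v∉)
    }
    where
    clean-rep : ∀ {w} → v ∉ S → Clean v → Clean w → Conn v w → ∃[ i ] ι i ≡ w → ∃[ i ] Rep v i
    clean-rep v∉ cv cw vw (i , refl) = i , by-clean v∉ cv cw vw

    few-ends : length (map ι (ends L)) ≤ k + k
    few-ends = ≤-trans (≤-reflexive (trans (length-map ι (ends L)) (length-ends L))) (+-mono-≤ budgeted budgeted)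

    twin-rep : v ∉ S → ∃[ w ] w ∈ S × twin v w ≡ true × w ∉ map ι (ends L) → ∃[ i ] Rep v i
    twin-rep v∉ (w , w∈ , t , w∉) = go (index w∈)
      where
      go : ∃[ i ] ι i ≡ w → ∃[ i ] Rep v i
      go (i , refl) = i , by-twin v∉ (twin⁻ t) (w∉ ∘ ∈-map⁺ ι)

  rep-conn : ∀ {v i} → Near v → Rep v i → Conn v (ι i)
  rep-conn nv (itself refl)         = near-refl nv
  rep-conn nv (by-clean _ _ _ vi)   = vi
  rep-conn nv (by-twin _ t _)       = twin-conn nv t

  rep-clean : ∀ {v i} → Near v → Rep v i → Clean v → Clean (ι i)
  rep-clean nv (itself refl)       cv = cv
  rep-clean nv (by-clean _ _ ci _) cv = ci
  rep-clean nv (by-twin _ t _)     cv = twin-clean (twin-conn nv t) t cv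

  rep-twin : ∀ {v i} → clean v ≡ false → Rep v i → Twin v (ι i)
  rep-twin cv (itself refl)        z = refl
  rep-twin cv (by-clean _ cv′ _ _) z = clash cv′ cv
  rep-twin cv (by-twin _ t _)        = t

  rep-kept : ∀ {i j} → Rep (ι i) j → j ≡ i
  rep-kept (itself eq)            = ι-injective eq
  rep-kept {i} (by-clean i∉ _ _ _) = ⊥-elim (i∉ (ι∈S i))
  rep-kept {i} (by-twin i∉ _ _)    = ⊥-elim (i∉ (ι∈S i))

  -- The critical case is a clean `v` represented by a clean vertex. A non-adjacent `ι i` would be a
  -- twin of that vertex and so clean, and then its twin `u` would be clean too.
  rep-adj-unclean : ∀ {u v i j} → Near u → clean u ≡ false → Rep u i → Rep v j → Adj G u v → Adj G (ι i) (ι j)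
  rep-adj-unclean {u} {v} {i} {j} nu cu ri rj uv = go rj
    where
    iv : Adj G (ι i) v
    iv = trans (≡-sym (rep-twin cu ri v)) uv
    go : Rep v j → Adj G (ι i) (ι j)
    go (itself refl) = iv
    go (by-twin _ t _) = Adj-sym G (trans (≡-sym (t (ι i))) (Adj-sym G iv))
    go (by-clean _ _ cj vj) with true⊎false (adj G (ι i) (ι j))
    ... | inj₁ ij = ij
    ... | inj₂ ij = clash (twin-clean ic-conn ci-twin ci) cu
      where
      ui : Conn u (ι i)
      ui = rep-conn nu ri
      ji : Conn (ι j) (ι i)
      ji = conn-trans (conn-sym (conn-trans (conn-adj uv) vj)) ui
      ci : Clean (ι i)
      ci = twin-clean ji (clean⁻ cj ji (Non-sym G ij)) cj
      ic-conn : Conn (ι i) u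
      ic-conn = conn-sym ui
      ci-twin : Twin (ι i) u
      ci-twin = Twin-sym (rep-twin cu ri)

  -- An edge between two clean vertices collapses, as a component has only one kept clean vertex.
  rep-adj : ∀ {u v i j} → Near u → Rep u i → Rep v j → Adj G u v → Adj G (ι i) (ι j) ⊎ i ≡ j
  rep-adj {u} {v} {i} {j} nu ri rj uv = go (true⊎false (clean u)) (true⊎false (clean v))
    where
    nv : Near v
    nv = near-conn (conn-adj uv) nu
    go : clean u ≡ true ⊎ clean u ≡ false → clean v ≡ true ⊎ clean v ≡ false → Adj G (ι i) (ι j) ⊎ i ≡ j
    go (inj₂ cu) _         = inj₁ (rep-adj-unclean nu cu ri rj uv)
    go (inj₁ _)  (inj₂ cv) = inj₁ (Adj-sym G (rep-adj-unclean nv cv rj ri (Adj-sym G uv)))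
    go (inj₁ cu) (inj₁ cv) = inj₂ (ι-injective (S-clean (ι∈S i) (ι∈S j) (rep-clean nu ri cu) (rep-clean nv rj cv)
      (conn-trans (conn-sym (rep-conn nu ri)) (conn-trans (conn-adj uv) (rep-conn nv rj)))))

  -- Walks of `G` are carried over by replacing vertices by representatives: an edge may collapse
  -- but does not break. At the end, `rep-kept` says that a kept vertex is represented by itself
  -- only.
  H-connected : ∀ (P : Fin m → Set) → (∀ {i j} → Adj H i j → P i → P j) →
    ∀ {i j} → Conn (ι i) (ι j) → P i → P j
  H-connected P closed {i} {j} ij pi =
    let _ , l , r , pl = conn-min Q closed-Q ij (S-near (ι∈S i) , i , itself refl , pi)
    in subst P (rep-kept r) pl
    where
    Q : Fin n → Set
    Q v = Near v × ∃[ l ] Rep v l × P l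
    closed-Q : ∀ {u v} → Adj G u v → Q u → Q v
    closed-Q {u} {v} uv (nu , l , ru , pl) =
      let nv = near-conn (conn-adj uv) nu
          l′ , rv = rep nv
      in nv , l′ , rv , [ (λ ll′ → closed (old completes ll′) pl) , (λ eq → subst P eq pl) ]′ (rep-adj nu ru rv uv)

  -- The triangle comes from a paw of `G`, whose vertices need not be kept. Its pendant vertex makes
  -- `a` and `b` unclean, so each edge of the triangle has an unclean end and survives the passage
  -- to representatives.
  multipartite : ∀ {x p q r} → Near x → Conn x (ι p) → Conn x (ι q) → Conn x (ι r) →
    Adj H p q → Non H p r → Non H q r → ⊥
  multipartite {x} nx =
    let a , b , c , d , isPaw ab bc ac cd ad bd , xa = near⁻ nx
        na = near-conn xa nx
        xb = conn-trans xa (conn-adj ab)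
        nb = near-conn xb nx
        nc = near-conn (conn-trans xa (conn-adj ac)) nx
        nd = near-conn (conn-trans xa (conn-trans (conn-adj ac) (conn-adj cd))) nx
        cua = pendant-unclean ab (conn-trans (conn-adj ac) (conn-adj cd)) ad bd
        cub = pendant-unclean (Adj-sym G ab) (conn-trans (conn-adj bc) (conn-adj cd)) bd ad
        i , ri = rep na
        j , rj = rep nb
        l , rl = rep nc
    in Multipartite.multipartite H free (λ i → Conn x (ι i))
         (λ P closed ci cj → H-connected P closed (conn-trans (conn-sym ci) cj))
         ( old completes (rep-adj-unclean na cua ri rj ab)
         , old completes (rep-adj-unclean nb cub rj rl bc)
         , old completes (rep-adj-unclean na cua ri rl ac) )
         (conn-trans xa (rep-conn na ri))
    where
    pendant-unclean : ∀ {a b d} → Adj G a b → Conn a d → Non G a d → Non G b d → clean a ≡ false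
    pendant-unclean {a} {b} {d} ab a-d ad bd with true⊎false (clean a)
    ... | inj₂ ca = ca
    ... | inj₁ ca = clash (Adj-sym G (trans (≡-sym (clean⁻ ca a-d ad b)) ab)) bd

  module _ (H′ : Graph n) (comp : Completes G L′ H′) where

    -- A deleted vertex is not an endpoint in `L′` and its representative is untouched, so both
    -- sides reduce to `G`. Between two kept vertices an added pair is useful and therefore present
    -- in `L′`.
    rep-H′ : ∀ {u v i j} → Conn u v → clean u ≡ false → clean v ≡ false → Rep u i → Rep v j →
      adj H′ u v ≡ adj H i j
    rep-H′ uv cu cv (by-clean _ cu′ _ _) rj = clash cu′ cu
    rep-H′ uv cu cv (itself refl) (by-clean _ cv′ _ _) = clash cv′ cv
    rep-H′ uv cu cv (by-twin _ _ _) (by-clean _ cv′ _ _) = clash cv′ cv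
    rep-H′ {u} {v} {i} {j} uv cu cv ri@(by-twin u∉ _ i∉) rj = trans
      (≡-from-⇔ (λ h → [ id , (λ h → ⊥-elim (u∉ (kept-end h))) ]′ (adj⁻ comp h)) (old comp))
      (trans (twins (rep-twin cu ri) (rep-twin cv rj)) (≡-sym (fixed i∉ j)))
      where
      kept-end : Joined L′ u v → u ∈ S
      kept-end h = let (i , _ , eq , _) , _ = joined-L′⁻ h in subst (_∈ S) eq (ι∈S i)
      twins : Twin u (ι i) → Twin v (ι j) → adj G u v ≡ adj G (ι i) (ι j)
      twins tu tv = trans (tu v) (trans (Graph.sym G (ι i) v) (trans (tv (ι i)) (Graph.sym G (ι j) (ι i))))
    rep-H′ {u} {v} {i} {j} uv cu cv ri@(itself refl) rj@(by-twin v∉ tv j∉) = trans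
      (≡-from-⇔ (λ h → [ id , (λ h → ⊥-elim (v∉ (kept-end h))) ]′ (adj⁻ comp h)) (old comp))
      (trans (Graph.sym G (ι i) v) (trans (tv (ι i)) (trans (≡-sym (fixed j∉ i)) (Graph.sym H j i))))
      where
      kept-end : Joined L′ (ι i) v → v ∈ S
      kept-end h = let (_ , j , _ , eq , _) , _ = joined-L′⁻ h in subst (_∈ S) eq (ι∈S j)
    rep-H′ {i = i} {j} uv cu cv (itself refl) (itself refl) = ≡-from-⇔ to from
      where
      to : Adj H′ (ι i) (ι j) → Adj H i j
      to h = adj⁺ completes (λ { refl → Adj⇒≢ H′ h refl })
        (Sum.map₂ (λ q → let (i′ , j′ , ei , ej , h) , _ = joined-L′⁻ q in
                     subst₂ (Joined L) (ι-injective ei) (ι-injective ej) h) (adj⁻ comp h))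
      from : Adj H i j → Adj H′ (ι i) (ι j)
      from h = adj⁺ comp (Adj⇒≢ H h ∘ ι-injective) (Sum.map₂ (λ q → joined-L′⁺ q (uv , cu , cv)) (adj⁻ completes h))

    H′-conn : ∀ {u v} → Adj H′ u v → Conn u v
    H′-conn h = [ conn-adj , (λ j → proj₁ (proj₂ (joined-L′⁻ j))) ]′ (adj⁻ comp h)

    clean-fixed : ∀ {u v} → Clean u → Adj H′ u v → Adj G u v
    clean-fixed cu h = [ id , (λ j → clash cu (proj₁ (proj₂ (proj₂ (joined-L′⁻ j))))) ]′ (adj⁻ comp h)

    -- A clean `p` would be a twin of `r` in `G`. Its edge to `q` was not added, so `r` would be
    -- adjacent to `q` as well.
    unclean-endpoint : ∀ {p q r} → Conn p r → Adj H′ p q → Non H′ p r → Non H′ q r → clean p ≡ false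
    unclean-endpoint {p} {q} {r} p-r pq pr qr with true⊎false (clean p)
    ... | inj₂ cp = cp
    ... | inj₁ cp = clash (Adj-sym G (trans (≡-sym (clean⁻ cp p-r (old-non comp pr) q)) (clean-fixed cp pq))) (old-non comp qr)

    unclean-third : ∀ {p q r} → Conn r p → Adj H′ p q → Non H′ p r → Non H′ q r → clean r ≡ false
    unclean-third {p} {q} {r} r-p pq pr qr with true⊎false (clean r)
    ... | inj₂ cr = cr
    ... | inj₁ cr = clash (twin-clean r-p (clean⁻ cr r-p (Non-sym G (old-non comp pr))) cr)
                          (unclean-endpoint (conn-sym r-p) pq pr qr)

    multipartite′ : ∀ {p q r} → Near p → Conn p r → Adj H′ p q → Non H′ p r → Non H′ q r → ⊥
    multipartite′ {p} {q} {r} np p-r pq pr qr =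
      let p-q = H′-conn pq
          q-r = conn-trans (conn-sym p-q) p-r
          cp  = unclean-endpoint p-r pq pr qr
          cq  = unclean-endpoint q-r (Adj-sym H′ pq) qr pr
          cr  = unclean-third (conn-sym p-r) pq pr qr
          nq  = near-conn p-q np
          nr  = near-conn p-r np
          i , ri = rep np
          j , rj = rep nq
          l , rl = rep nr
      in multipartite np (rep-conn np ri) (conn-trans p-q (rep-conn nq rj)) (conn-trans p-r (rep-conn nr rl))
           (trans (≡-sym (rep-H′ p-q cp cq ri rj)) pq)
           (trans (≡-sym (rep-H′ p-r cp cr ri rl)) pr)
           (trans (≡-sym (rep-H′ q-r cq cr rj rl)) qr)

    H′-free : PawFree H′
    H′-free copy = by-nearness (copy⇒paw copy)
      where
      by-nearness : ∀ {a b c d} → IsPaw H′ a b c d → ⊥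
      by-nearness {a} {b} {c} {d} (isPaw ab bc ac cd ad bd) =
        [ (λ na → multipartite′ (near na) (conn-trans (H′-conn ac) (H′-conn cd)) ab ad bd) , far ]′ (true⊎false (nearPaw a))
        where
        -- All endpoints in `L′` are near a paw. In any other component nothing is added, so the paw
        -- would already be one of `G`.
        far : nearPaw a ≡ false → ⊥
        far fa = clash (near-true (near⁺ paw-G (conn-trans (conn-adj old-ab) (conn-sym (conn-adj old-ab))))) fa
          where
          unadded : ∀ {u v} → Conn u a → Adj H′ u v → Adj G u v
          unadded ua h = [ id , (λ j → let (i , _ , eq , _) , _ = joined-L′⁻ j in
            clash (near-true (near-conn ua (S-near (subst (_∈ S) eq (ι∈S i))))) fa) ]′ (adj⁻ comp h)
          ba = conn-sym (H′-conn ab)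
          ca = conn-sym (H′-conn ac)
          old-ab : Adj G a b
          old-ab = unadded (conn-trans (H′-conn ab) ba) ab
          paw-G : IsPaw G a b c d
          paw-G = isPaw old-ab (unadded ba bc) (unadded (conn-trans (H′-conn ab) ba) ac) (unadded ca cd)
                    (old-non comp ad) (old-non comp bd)

  lift : PawFreeEdgeAddition ⟨ G , k ⟩
  lift = addition L′ length-L′ H′-free

-- Equivalence and size of the kernel

lookup-injective : ∀ {A : Set} {xs : List A} → Unique xs → ∀ {i j} → List.lookup xs i ≡ List.lookup xs j → i ≡ j
lookup-injective (x∉ ∷ uniq) {zero}  {zero}  eq = refl
lookup-injective (x∉ ∷ uniq) {zero}  {suc j} eq = ⊥-elim (All.lookup x∉ (∈-lookup j) eq)
lookup-injective (x∉ ∷ uniq) {suc i} {zero}  eq = ⊥-elim (All.lookup x∉ (∈-lookup i) (≡-sym eq))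
lookup-injective (x∉ ∷ uniq) {suc i} {suc j} eq = cong suc (lookup-injective uniq eq)

reverse-unique : ∀ {A : Set} {xs : List A} → Unique xs → Unique (reverse xs)
reverse-unique {A} {xs} = Permutation.Unique-resp-↭ (setoid A) (↭⇒↭ₛ (↭-sym (↭-reverse xs)))

paw-unsolvable : ¬ PawFreeEdgeAddition ⟨ paw , 0 ⟩
paw-unsolvable ([] , _ , _ , _ , free) = free (paw⇒copy {a = x₁} {x₂} {x₃} {x₄} (isPaw refl refl refl refl refl refl))

module _ {n : ℕ} (G : Graph n) (k : ℕ) where

  ι : Fin (length (reverse (kept G k))) → Fin n
  ι = List.lookup (reverse (kept G k))

  ι-injective : ∀ {i j} → ι i ≡ ι j → i ≡ j
  ι-injective = lookup-injective (reverse-unique (Kept.S-unique G k))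

  ι∈kept : ∀ i → ι i ∈ kept G k
  ι∈kept i = reverse⁻ (∈-lookup i)

  ι-index : ∀ {v} → v ∈ kept G k → ∃[ i ] ι i ≡ v
  ι-index v∈ = Any.index (reverse⁺ v∈) , ≡-sym (lookup-index (reverse⁺ v∈))

  decided-equivalent : ∀ b → (length (kept G k) ≤ᵇ limit k) ≡ b →
    PawFreeEdgeAddition ⟨ G , k ⟩ ⇔ PawFreeEdgeAddition (decided ⟨ G , k ⟩ b)
  decided-equivalent true  _   = mk⇔ (restrict ι ι-injective)
    (λ solvable → Lift.lift G k ι ι-injective ι∈kept ι-index (solution solvable))
  decided-equivalent false big = mk⇔
    (λ solvable → ⊥-elim (<-irrefl refl (<-≤-trans (≤ᵇ-false⁻ big) (Size.size-bound G k (solution solvable)))))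
    (λ solvable → ⊥-elim (paw-unsolvable solvable))

  decided-budget : ∀ b → budget (decided ⟨ G , k ⟩ b) ≤ k
  decided-budget true  = ≤-refl
  decided-budget false = z≤n

  decided-order : ∀ b → (length (kept G k) ≤ᵇ limit k) ≡ b → order (decided ⟨ G , k ⟩ b) ≤ limit k + 4
  decided-order true  small = ≤-trans (≤-reflexive (length-reverse (kept G k))) (≤-trans (≤ᵇ-true⁻ small) (m≤m+n (limit k) 4))
  decided-order false _     = m≤n+m 4 (limit k)

-- The bound is the quadratic `4k² + 6k + 4`, with 4 for the order of the paw. The factor 14 is its
-- value at 1, and `slack k` is the difference of the two sides at `1 + k`.
limit-cubic : (λ k → limit k + 4) ∈O (λ k → k ^ 3)
limit-cubic = 14 , 1 , λ { (suc k) _ → ≤-trans (m≤m+n _ (slack k)) (≤-reflexive (expand-cube k)) }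
  where
  slack : ℕ → ℕ
  slack k = k * (28 + k * (38 + k * 14))
  expand-cube : ∀ k → (1 + k) * ((1 + k) + ((1 + k) + ((1 + k) + ((1 + k) + 6)))) + 4
    + k * (28 + k * (38 + k * 14)) ≡ 14 * ((1 + k) * ((1 + k) * ((1 + k) * 1)))
  expand-cube = solve-∀

theorem4 : Σ[ kernel ∈ (Instance → Instance) ]
    PolynomialTime encodeInstance encodeInstance kernel
    × (∀ I → PawFreeEdgeAddition I ⇔ PawFreeEdgeAddition (kernel I))
    × (∀ I → budget (kernel I) ≤ budget I)
    × (Σ[ g ∈ (ℕ → ℕ) ] (g ∈O (λ k → k ^ 3)) × (∀ I → order (kernel I) ≤ g (budget I)))
theorem4 = kernel
  , kernel-polynomialTime
  , (λ { ⟨ G , k ⟩ → decided-equivalent G k _ refl })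
  , (λ { ⟨ G , k ⟩ → decided-budget G k (length (kept G k) ≤ᵇ limit k) })
  , (λ k → limit k + 4) , limit-cubic , (λ { ⟨ G , k ⟩ → decided-order G k _ refl })
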